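{- Let $\Xi_F=(S,\mathrm{wt})$ be a full passport with $|S|=N\ge 2$. Then the number of positive tree permutations of $\Xi_F$ is \[ |\mathbf{PT}_+(\Xi_F)| = \sum_{\mathfrak{p}\in\mathfrak{P}(\Xi_F)} (-1)^{|\mathfrak{p}|-1}(N-1)^{|\mathfrak{p}|-1} X(\mathfrak{p}). \]
   Context: A full passport $\Xi_F=(S,\mathrm{wt})$ consists of a finite set $S$ and a function $\mathrm{wt}:S\to\mathbb{R}\setminus\{0\}$ with $\sum_{s\in S}\mathrm{wt}(s)=0$. For a nonempty $S'\subseteq S$ with $\sum_{s\in S'}\mathrm{wt}(s)=0$, the subpassport $\Xi(S')$ is $(S',\mathrm{wt}|_{S'})$. A partition of $\Xi_F$ is a set $\mathfrak{p}=\{\Xi(S_1),\dots,\Xi(S_n)\}$ of subpassports with $S=\bigsqcup_i S_i$, each $S_i$ nonempty of zero weight sum; $|\mathfrak{p}|=n$ and $X(\mathfrak{p})=\prod_{i=1}^n(|S_i|-1)!$; $\mathfrak{P}(\Xi_F)$ is the set of all partitions. A permutation of $\Xi_F$ is a sequence $(s_1,\dots,s_N)$ listing each element of $S$ once, with cumulative sums $H_0=0$, $H_i=\sum_{j=1}^i\mathrm{wt}(s_j)$ (so $H_N=0$). It is positive if $H_i>0$ for all $1\le i\le N-1$. It is a tree permutation if (1) $H_i\neq 0$ for all $1\le i\le N-1$; (2) whenever $1\le k<l\le N$ and $H_{k-1}=H_l>0$, then $\min\{H_k,\dots,H_{l-1}\}<H_{k-1}$; (3) whenever $1\le k<l\le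 N$ and $H_{k-1}=H_l<0$, then $\max\{H_k,\dots,H_{l-1}\}>H_{k-1}$. $\mathbf{PT}_+(\Xi_F)$ is the set of permutations that are both positive and tree permutations. -}

module Defs where

open import Level using (0ℓ)
open import Data.Nat as ℕ using (ℕ; _!; zero; suc; _∸_; _≤_; _<_; _≤?_; _<?_)
open import Data.Integer as ℤ using (ℤ; +_; -[1+_])
open import Data.Fin using (Fin; toℕ)
open import Data.Fin.Properties using (all?; any?)
open import Data.List using (List; []; _∷_; [_]; map; concatMap; foldr; length; take; filter; allFin)
open import Data.List.Relation.Unary.All using (All)
import Data.List.Relation.Unary.All as All
open import Data.Product using (Σ; ∃; _×_; _,_)
open import Relation.Nullary using (¬_; Dec; yes; no)
open import Relation.Nullary.Decidable using (_×-dec_; _→-dec_; ¬?)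
open import Relation.Binary.PropositionalEquality using (_≡_; _≢_)
open import Relation.Binary.Structures using (IsStrictTotalOrder)
open import Algebra.Structures using (IsAbelianGroup)

-- Totally ordered abelian groups (the weights of a passport live in ℝ;
-- we allow any totally ordered abelian group).

record OrdAbGroup : Set₁ where
  infixl 6 _+_
  infix 4 _<ᵍ_
  field
    Carrier        : Set
    _+_            : Carrier → Carrier → Carrier
    0#             : Carrier
    -_             : Carrier → Carrier
    _<ᵍ_           : Carrier → Carrier → Set
    isAbelianGroup : IsAbelianGroup _≡_ _+_ 0# -_
    isStrictTotalOrder : IsStrictTotalOrder _≡_ _<ᵍ_
    +-monoʳ-<      : ∀ {x y} z → x <ᵍ y → x + z <ᵍ y + z

  open IsStrictTotalOrder isStrictTotalOrder public renaming (_<?_ to _<ᵍ?_) using (_≟_)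

  Σ[_] : List Carrier → Carrier
  Σ[ xs ] = foldr _+_ 0# xs

insertEverywhere : {A : Set} → A → List A → List (List A)
insertEverywhere x []       = (x ∷ []) ∷ []
insertEverywhere x (y ∷ ys) = (x ∷ y ∷ ys) ∷ map (y ∷_) (insertEverywhere x ys)

-- all orderings (permutations) of a list; for a duplicate-free list each
-- ordering occurs exactly once
permutations : {A : Set} → List A → List (List A)
permutations []       = [] ∷ []
permutations (x ∷ xs) = concatMap (insertEverywhere x) (permutations xs)

insertIntoBlock : {A : Set} → A → List (List A) → List (List (List A))
insertIntoBlock x []       = []
insertIntoBlock x (b ∷ bs) = ((x ∷ b) ∷ bs) ∷ map (b ∷_) (insertIntoBlock x bs)

-- all set partitions of a list into nonempty blocks; for a duplicate-free
-- list each set partition occurs exactly once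
setPartitions : {A : Set} → List A → List (List (List A))
setPartitions []       = [] ∷ []
setPartitions (x ∷ xs) =
  concatMap (λ p → ((x ∷ []) ∷ p) ∷ insertIntoBlock x p) (setPartitions xs)

sumℤ : List ℤ → ℤ
sumℤ = foldr ℤ._+_ (+ 0)

productℕ : List ℕ → ℕ
productℕ = foldr ℕ._*_ 1

module Passport (G : OrdAbGroup) where
  open OrdAbGroup G

  IsFullPassport : (N : ℕ) → (Fin N → Carrier) → Set
  IsFullPassport N wt = (∀ s → wt s ≢ 0#) × (Σ[ map wt (allFin N) ] ≡ 0#)

  H : List Carrier → ℕ → Carrier
  H ws i = Σ[ take i ws ]

  module _ (ws : List Carrier) where
    private
      n = length ws
      Hf : Fin (suc n) → Carrier
      Hf i = H ws (toℕ i)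

    IsPositive : Set
    IsPositive = ∀ (i : Fin (suc n)) → 1 ≤ toℕ i → toℕ i < n → 0# <ᵍ Hf i

    TreeCond1 : Set
    TreeCond1 = ∀ (i : Fin (suc n)) → 1 ≤ toℕ i → toℕ i < n → ¬ (Hf i ≡ 0#)

    TreeCond2 : Set
    TreeCond2 = ∀ (k l : Fin (suc n)) → 1 ≤ toℕ k → toℕ k < toℕ l →
      H ws (toℕ k ∸ 1) ≡ Hf l → 0# <ᵍ Hf l →
      ∃ λ (j : Fin (suc n)) → toℕ k ≤ toℕ j × toℕ j < toℕ l × Hf j <ᵍ H ws (toℕ k ∸ 1)

    TreeCond3 : Set
    TreeCond3 = ∀ (k l : Fin (suc n)) → 1 ≤ toℕ k → toℕ k < toℕ l →
      H ws (toℕ k ∸ 1) ≡ Hf l → Hf l <ᵍ 0# →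
      ∃ λ (j : Fin (suc n)) → toℕ k ≤ toℕ j × toℕ j < toℕ l × H ws (toℕ k ∸ 1) <ᵍ Hf j

    IsTree : Set
    IsTree = TreeCond1 × TreeCond2 × TreeCond3

    IsPositiveTree : Set
    IsPositiveTree = IsPositive × IsTree

    isPositiveTree? : Dec IsPositiveTree
    isPositiveTree? = pos? ×-dec (c1? ×-dec (c2? ×-dec c3?))
      where
      pos? = all? λ i → (1 ≤? toℕ i) →-dec ((toℕ i <? n) →-dec (0# <ᵍ? Hf i))
      c1?  = all? λ i → (1 ≤? toℕ i) →-dec ((toℕ i <? n) →-dec ¬? (Hf i ≟ 0#))
      c2?  = all? λ k → all? λ l → (1 ≤? toℕ k) →-dec ((toℕ k <? toℕ l) →-dec
               ((H ws (toℕ k ∸ 1) ≟ Hf l) →-dec ((0# <ᵍ? Hf l) →-dec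
               any? λ j → (toℕ k ≤? toℕ j) ×-dec ((toℕ j <? toℕ l) ×-dec
                           (Hf j <ᵍ? H ws (toℕ k ∸ 1))))))
      c3?  = all? λ k → all? λ l → (1 ≤? toℕ k) →-dec ((toℕ k <? toℕ l) →-dec
               ((H ws (toℕ k ∸ 1) ≟ Hf l) →-dec ((Hf l <ᵍ? 0#) →-dec
               any? λ j → (toℕ k ≤? toℕ j) ×-dec ((toℕ j <? toℕ l) ×-dec
                           (H ws (toℕ k ∸ 1) <ᵍ? Hf j)))))

  module _ {N : ℕ} (wt : Fin N → Carrier) where
    numPT₊ : ℕ
    numPT₊ = length (filter (λ σ → isPositiveTree? (map wt σ)) (permutations (allFin N)))

    ZeroBlock : List (Fin N) → Set
    ZeroBlock b = Σ[ map wt b ] ≡ 0#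

    partitionsΞ : List (List (List (Fin N)))
    partitionsΞ = filter (λ p → All.all? (λ b → Σ[ map wt b ] ≟ 0#) p)
                         (setPartitions (allFin N))

    X : List (List (Fin N)) → ℕ
    X p = productℕ (map (λ b → (length b ∸ 1) !) p)

    term : List (List (Fin N)) → ℤ
    term p = (-[1+ 0 ] ℤ.^ (length p ∸ 1)) ℤ.* ((+ (N ∸ 1)) ℤ.^ (length p ∸ 1)) ℤ.* (+ X p)

    rhs : ℤ
    rhs = sumℤ (map term partitionsΞ)

-- Functions on finite sets form a commutative ring under (a ⊛ b)(S) = Σ a(T) b(S ∖ T),
-- with derivation D a(S) = |S| a(S), and Φ, which sums a function of words over all
-- orderings of S, turns concatenation into ⊛.  Let C(S) = (|S| - 1)! if S has weight sum
-- zero and C(S) = 0 otherwise; exp k is the k-th power of e^C, so that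
-- exp k (S) = Σ over partitions of k^|p| X(p), and the claim becomes
-- (1 - N) f(S) = exp (1 - N) (S) for the number f of positive tree permutations.
--
-- Let E count the orderings whose walk stays nonnegative and ends at 0.  Cutting words at
-- their first and last minimum gives D E = D C ⊛ E, hence E = e^C (Spitzer).  On the other
-- hand every word reduces to a unique excursion-free word by deleting nonnegative closed
-- walks, so a nonempty nonnegative closed walk is a positive tree word x₁ … xₘ with such
-- walks inserted after each letter: E = 1 + Σ_T f(T) E^|T|.  Lagrange inversion, i.e.
-- comparing D E ⊛ E^(-N) on S computed in both ways, finishes the proof.

module Submission where

open import Defs
open import Data.Nat using (ℕ; _≤_)
open import Data.Integer using (+_)
open import Data.Fin using (Fin)
open import Relation.Binary.PropositionalEquality using (_≡_)

open import Algebra.Bundles using (AbelianGroup)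
import Algebra.Properties.Group as GroupProperties
open import Algebra.Structures using (IsAbelianGroup)
open import Data.Fin using (toℕ; fromℕ<; zero; suc)
open import Data.Fin.Properties using (toℕ-fromℕ<; toℕ<n)
open import Data.Bool using (true; false; if_then_else_)
open import Data.Integer using (ℤ; 0ℤ; 1ℤ; -1ℤ; _+_; _-_; -_; _*_; _^_)
open import Data.Integer.Properties
open import Data.Integer.Tactic.RingSolver using (solve-∀)
open import Data.List using (List; []; _∷_; _++_; map; concatMap; filter; length; take; tabulate; allFin)
open import Data.List.Properties using (length-++; length-map; length-tabulate; take-map; take-all)
open import Data.List.Relation.Binary.Permutation.Propositional as Perm
  using (_↭_; ↭-refl; ↭-trans; ↭-prep; ↭-swap)
open import Data.List.Relation.Binary.Permutation.Propositional.Properties using (↭-length)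
open import Data.List.Relation.Ternary.Interleaving.Propositional
  using (Interleaving; []; consˡ; consʳ; toPermutation)
open import Data.List.Relation.Ternary.Interleaving.Properties using (interleave-length)
open import Data.List.Relation.Unary.All as All using (All; []; _∷_)
import Data.List.Relation.Unary.All.Properties as All
open import Data.Nat as ℕ using (zero; suc; z≤n; s≤s; _∸_; _!)
import Data.Nat.Properties as ℕ
open import Data.Product using (∃-syntax; _×_; _,_)
open import Data.Sum using (_⊎_; inj₁; inj₂)
open import Function using (_∘_; case_of_; flip)
open import Relation.Binary.Definitions using (Tri; tri<; tri≈; tri>)
open import Relation.Binary.PropositionalEquality
open import Relation.Binary.Structures using (IsStrictTotalOrder)
open import Relation.Nullary using (¬_; Dec; does; yes; no; contradiction)
open import Relation.Nullary.Decidable using (_×-dec_; decidable-stable; map′)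

open ≡-Reasoning
open GroupProperties (AbelianGroup.group +-0-abelianGroup) using ()
  renaming (∙-cancelˡ to ℤ-cancelˡ; ∙-cancelʳ to ℤ-cancelʳ)

-- The equation D E = D C ⊛ E rests on excursions, the nonempty walks that stay positive and return
-- to 0 only at their end. Let P count the orderings that are excursions. Cutting at the first
-- return gives E = 1 + P ⊛ E, so E is inverse to 1 - P. In a word of sum zero, the part between the
-- first and the last minimum is counted by E, and the two outer parts, glued in the opposite order,
-- form an excursion with a marked interior cut, or nothing. Corrected by E = 1 + P ⊛ E this reads D
-- C = E ⊛ D P, hence D E = E ⊛ D P ⊛ E = D C ⊛ E. In other words C = -log(1 - P), but D and the
-- cancellation of nonzero integers replace the logarithm and all denominators. Properties of words
-- are indicators with values in ℤ, so that existence and uniqueness of a decomposition become one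
-- equation between a sum over cuts and the indicator of the whole word. The powers of N - 1 come
-- from the exponent 1 - N in Lagrange inversion. The inversion formula itself carries the factor 1
-- - N, and cancelling it is where N ≥ 2 enters.

+-congˡ : ∀ a {b c} → b ≡ c → a + b ≡ a + c
+-congˡ a = cong (λ z → a + z)

+-interchange : ∀ a b c d → (a + b) + (c + d) ≡ (a + c) + (b + d)
+-interchange = solve-∀

*-swapˡ : ∀ a b c → a * (b * c) ≡ b * (a * c)
*-swapˡ = solve-∀

-- Sums over splittings, cuts and permutations

∑ : ∀ {B : Set} → List B → (B → ℤ) → ℤ
∑ []       φ = 0ℤ
∑ (x ∷ xs) φ = φ x + ∑ xs φ

∑-congAll : ∀ {B : Set} {φ χ : B → ℤ} {xs} → All (λ x → φ x ≡ χ x) xs → ∑ xs φ ≡ ∑ xs χ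
∑-congAll []       = refl
∑-congAll (p ∷ ps) = cong₂ _+_ p (∑-congAll ps)

∑-cong : ∀ {B : Set} {φ χ : B → ℤ} xs → (∀ x → φ x ≡ χ x) → ∑ xs φ ≡ ∑ xs χ
∑-cong xs h = ∑-congAll (All.universal h xs)

∑-++ : ∀ {B : Set} (xs ys : List B) φ → ∑ (xs ++ ys) φ ≡ ∑ xs φ + ∑ ys φ
∑-++ []       ys φ = sym (+-identityˡ _)
∑-++ (x ∷ xs) ys φ = trans (+-congˡ (φ x) (∑-++ xs ys φ)) (sym (+-assoc (φ x) _ _))

∑-map : ∀ {B C : Set} (g : B → C) xs φ → ∑ (map g xs) φ ≡ ∑ xs (φ ∘ g)
∑-map g []       φ = refl
∑-map g (x ∷ xs) φ = +-congˡ (φ (g x)) (∑-map g xs φ)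

∑-concatMap : ∀ {B C : Set} (g : B → List C) xs φ → ∑ (concatMap g xs) φ ≡ ∑ xs (λ x → ∑ (g x) φ)
∑-concatMap g []       φ = refl
∑-concatMap g (x ∷ xs) φ = trans (∑-++ (g x) (concatMap g xs) φ) (+-congˡ (∑ (g x) φ) (∑-concatMap g xs φ))

∑-distrib-+ : ∀ {B : Set} (xs : List B) φ χ → ∑ xs (λ x → φ x + χ x) ≡ ∑ xs φ + ∑ xs χ
∑-distrib-+ []       φ χ = refl
∑-distrib-+ (x ∷ xs) φ χ = trans (+-congˡ (φ x + χ x) (∑-distrib-+ xs φ χ)) (+-interchange (φ x) (χ x) _ _)

*-distribˡ-∑ : ∀ {B : Set} k (xs : List B) φ → ∑ xs (λ x → k * φ x) ≡ k * ∑ xs φ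
*-distribˡ-∑ k []       φ = sym (*-zeroʳ k)
*-distribˡ-∑ k (x ∷ xs) φ = trans (+-congˡ (k * φ x) (*-distribˡ-∑ k xs φ)) (sym (*-distribˡ-+ k (φ x) _))

module _ {A : Set} where

  -- Sets are lists in a fixed order, and a subset and its complement are complementary
  -- subsequences. The recursion absorbs the head into the summand, so identities are proved by
  -- induction on the list with the summand generalised.
  split : (List A → List A → ℤ) → List A → ℤ
  split ψ []      = ψ [] []
  split ψ (x ∷ S) = split (λ T U → ψ (x ∷ T) U) S + split (λ T U → ψ T (x ∷ U)) S

  cut : (List A → List A → ℤ) → List A → ℤ
  cut ψ []      = ψ [] []
  cut ψ (x ∷ w) = ψ [] (x ∷ w) + cut (λ u v → ψ (x ∷ u) v) w

  pick : (A → List A → ℤ) → List A → ℤ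
  pick ψ []      = 0ℤ
  pick ψ (x ∷ S) = ψ x S + pick (λ y U → ψ y (x ∷ U)) S

  -- The interleaving is the record that `T` and `U` together make up `S`; lengths and weight sums
  -- are later read off from it.
  split-cong : ∀ {ψ χ} S → (∀ {T U} → Interleaving T U S → ψ T U ≡ χ T U) → split ψ S ≡ split χ S
  split-cong []      h = h []
  split-cong (x ∷ S) h = cong₂ _+_ (split-cong S (h ∘ consˡ)) (split-cong S (h ∘ consʳ))

  split-distrib-+ : ∀ ψ χ S → split (λ T U → ψ T U + χ T U) S ≡ split ψ S + split χ S
  split-distrib-+ ψ χ []      = refl
  split-distrib-+ ψ χ (x ∷ S) = trans
    (cong₂ _+_ (split-distrib-+ (λ T → ψ (x ∷ T)) (λ T → χ (x ∷ T)) S)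
               (split-distrib-+ (λ T U → ψ T (x ∷ U)) (λ T U → χ T (x ∷ U)) S))
    (+-interchange (split (λ T → ψ (x ∷ T)) S) _ _ _)

  *-distribˡ-split : ∀ k ψ S → split (λ T U → k * ψ T U) S ≡ k * split ψ S
  *-distribˡ-split k ψ []      = refl
  *-distribˡ-split k ψ (x ∷ S) = trans
    (cong₂ _+_ (*-distribˡ-split k _ S) (*-distribˡ-split k _ S)) (sym (*-distribˡ-+ k (split _ S) _))

  split-zero : ∀ S → split (λ T U → 0ℤ) S ≡ 0ℤ
  split-zero []      = refl
  split-zero (x ∷ S) = cong₂ _+_ (split-zero S) (split-zero S)

  split-comm : ∀ ψ S → split ψ S ≡ split (flip ψ) S
  split-comm ψ []      = refl
  split-comm ψ (x ∷ S) = trans (cong₂ _+_ (split-comm _ S) (split-comm _ S)) (+-comm (split _ S) _)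

  -- Both sides send every element of `S` to one of three parts.
  split-assoc : ∀ (ψ : List A → List A → List A → ℤ) S →
    split (λ R V → split (λ T U → ψ T U V) R) S ≡ split (λ T R → split (ψ T) R) S
  split-assoc ψ []      = refl
  split-assoc ψ (x ∷ S) = begin
    split (λ R V → split (λ T U → ψ (x ∷ T) U V) R + split (λ T U → ψ T (x ∷ U) V) R) S
      + split (λ R V → split (λ T U → ψ T U (x ∷ V)) R) S
      ≡⟨ cong (_+ split (λ R V → split (λ T U → ψ T U (x ∷ V)) R) S) (split-distrib-+ _ _ S) ⟩
    split (λ R V → split (λ T U → ψ (x ∷ T) U V) R) S + split (λ R V → split (λ T U → ψ T (x ∷ U) V) R) S
      + split (λ R V → split (λ T U → ψ T U (x ∷ V)) R) S
      ≡⟨ cong₂ _+_ (cong₂ _+_ (split-assoc _ S) (split-assoc _ S)) (split-assoc _ S) ⟩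
    split (λ T R → split (λ U V → ψ (x ∷ T) U V) R) S + split (λ T R → split (λ U V → ψ T (x ∷ U) V) R) S
      + split (λ T R → split (λ U V → ψ T U (x ∷ V)) R) S
      ≡⟨ +-assoc (split (λ T R → split (λ U V → ψ (x ∷ T) U V) R) S) _ _ ⟩
    split (λ T R → split (λ U V → ψ (x ∷ T) U V) R) S + (split (λ T R → split (λ U V → ψ T (x ∷ U) V) R) S
      + split (λ T R → split (λ U V → ψ T U (x ∷ V)) R) S)
      ≡⟨ +-congˡ (split (λ T R → split (λ U V → ψ (x ∷ T) U V) R) S) (sym (split-distrib-+ _ _ S)) ⟩
    split (λ T R → split (ψ T) R) (x ∷ S) ∎

  cut-cong : ∀ {ψ χ} w → (∀ u v → u ++ v ≡ w → ψ u v ≡ χ u v) → cut ψ w ≡ cut χ w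
  cut-cong []      h = h [] [] refl
  cut-cong (x ∷ w) h = cong₂ _+_ (h [] (x ∷ w) refl) (cut-cong w (λ u v eq → h (x ∷ u) v (cong (x ∷_) eq)))

  cut-distrib-+ : ∀ ψ χ w → cut (λ u v → ψ u v + χ u v) w ≡ cut ψ w + cut χ w
  cut-distrib-+ ψ χ []      = refl
  cut-distrib-+ ψ χ (x ∷ w) = trans
    (+-congˡ (ψ [] (x ∷ w) + χ [] (x ∷ w)) (cut-distrib-+ _ _ w)) (+-interchange (ψ [] (x ∷ w)) _ _ _)

  *-distribˡ-cut : ∀ k ψ w → cut (λ u v → k * ψ u v) w ≡ k * cut ψ w
  *-distribˡ-cut k ψ []      = refl
  *-distribˡ-cut k ψ (x ∷ w) = trans
    (+-congˡ (k * ψ [] (x ∷ w)) (*-distribˡ-cut k _ w)) (sym (*-distribˡ-+ k _ _))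

  cut-zero : ∀ w → cut (λ u v → 0ℤ) w ≡ 0ℤ
  cut-zero []      = refl
  cut-zero (x ∷ w) = trans (+-identityˡ _) (cut-zero w)

  pick-cong : ∀ {ψ χ} S → (∀ y U → suc (length U) ≡ length S → ψ y U ≡ χ y U) → pick ψ S ≡ pick χ S
  pick-cong []      h = refl
  pick-cong (x ∷ S) h = cong₂ _+_ (h x S refl) (pick-cong S (λ y U eq → h y (x ∷ U) (cong suc eq)))

  pick-distrib-+ : ∀ ψ χ S → pick (λ y U → ψ y U + χ y U) S ≡ pick ψ S + pick χ S
  pick-distrib-+ ψ χ []      = refl
  pick-distrib-+ ψ χ (x ∷ S) = trans (+-congˡ (ψ x S + χ x S) (pick-distrib-+ _ _ S)) (+-interchange (ψ x S) _ _ _)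

  -- Both sides distribute the elements over a left and a right part and distinguish one element on
  -- the left.
  pick-split : ∀ (ψ : A → List A → List A → ℤ) S →
    pick (λ y → split (ψ y)) S ≡ split (λ T U → pick (λ y T′ → ψ y T′ U) T) S
  pick-split ψ []      = refl
  pick-split ψ (x ∷ S) = begin
    split (ψ x) S + pick (λ y U → split (λ T V → ψ y (x ∷ T) V) U + split (λ T V → ψ y T (x ∷ V)) U) S
      ≡⟨ +-congˡ (split (ψ x) S) (pick-distrib-+ _ _ S) ⟩
    split (ψ x) S + (pick (λ y U → split (λ T V → ψ y (x ∷ T) V) U) S + pick (λ y U → split (λ T V → ψ y T (x ∷ V)) U) S)
      ≡⟨ sym (+-assoc (split (ψ x) S) _ _) ⟩
    split (ψ x) S + pick (λ y U → split (λ T V → ψ y (x ∷ T) V) U) S + pick (λ y U → split (λ T V → ψ y T (x ∷ V)) U) S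
      ≡⟨ cong₂ _+_ (+-congˡ (split (ψ x) S) (pick-split _ S)) (pick-split _ S) ⟩
    split (ψ x) S + split (λ T U → pick (λ y T′ → ψ y (x ∷ T′) U) T) S + split (λ T U → pick (λ y T′ → ψ y T′ (x ∷ U)) T) S
      ≡⟨ cong (_+ split (λ T U → pick (λ y T′ → ψ y T′ (x ∷ U)) T) S) (sym (split-distrib-+ _ _ S)) ⟩
    split (λ T U → pick (λ y T′ → ψ y T′ U) T) (x ∷ S) ∎

  -- The convolution ring of set functions and the concatenation product of word functions

  𝟙 : List A → ℤ
  𝟙 []      = 1ℤ
  𝟙 (_ ∷ _) = 0ℤ

  infixl 7 _⊛_ _·_

  _⊛_ : (List A → ℤ) → (List A → ℤ) → List A → ℤ
  (a ⊛ b) S = split (λ T U → a T * b U) S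

  _·_ : (List A → ℤ) → (List A → ℤ) → List A → ℤ
  (φ · ψ) w = cut (λ u v → φ u * ψ v) w

  ⊛-cong : ∀ {a a′ b b′ : List A → ℤ} → a ≗ a′ → b ≗ b′ → a ⊛ b ≗ a′ ⊛ b′
  ⊛-cong p q S = split-cong S (λ {T} {U} _ → cong₂ _*_ (p T) (q U))

  ⊛-comm : ∀ a b → a ⊛ b ≗ b ⊛ a
  ⊛-comm a b S = trans (split-comm _ S) (split-cong S (λ {T} {U} _ → *-comm (a U) (b T)))

  ⊛-assoc : ∀ a b c → (a ⊛ b) ⊛ c ≗ a ⊛ (b ⊛ c)
  ⊛-assoc a b c S = begin
    split (λ R V → split (λ T U → a T * b U) R * c V) S
      ≡⟨ split-cong S (λ {R} {V} _ → trans (*-comm _ (c V)) (trans (sym (*-distribˡ-split (c V) _ R))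
           (split-cong R (λ {T} {U} _ → trans (*-comm (c V) _) (*-assoc (a T) (b U) (c V)))))) ⟩
    split (λ R V → split (λ T U → a T * (b U * c V)) R) S
      ≡⟨ split-assoc _ S ⟩
    split (λ T R → split (λ U V → a T * (b U * c V)) R) S
      ≡⟨ split-cong S (λ {T} {R} _ → *-distribˡ-split (a T) _ R) ⟩
    (a ⊛ (b ⊛ c)) S ∎

  ⊛-identityˡ : ∀ a → 𝟙 ⊛ a ≗ a
  ⊛-identityˡ a []      = *-identityˡ _
  ⊛-identityˡ a (x ∷ S) = trans (cong₂ _+_ (split-zero S) (⊛-identityˡ (a ∘ (x ∷_)) S)) (+-identityˡ _)

  ⊛-distribʳ-+ : ∀ a b c → (λ S → b S + c S) ⊛ a ≗ (λ S → (b ⊛ a) S + (c ⊛ a) S)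
  ⊛-distribʳ-+ a b c S = trans
    (split-cong S (λ {T} {U} _ → *-distribʳ-+ (a U) (b T) (c T)))
    (split-distrib-+ (λ T U → b T * a U) (λ T U → c T * a U) S)

  -- Sums over all orderings of a set

  insertions : A → (List A → ℤ) → List A → ℤ
  insertions x φ w = ∑ (insertEverywhere x w) φ

  insertions-∷ : ∀ x φ y w → insertions x φ (y ∷ w) ≡ φ (x ∷ y ∷ w) + insertions x (φ ∘ (y ∷_)) w
  insertions-∷ x φ y w = +-congˡ (φ (x ∷ y ∷ w)) (∑-map (y ∷_) (insertEverywhere x w) φ)

  insertions-↭ : ∀ (x : A) w → All (_↭ x ∷ w) (insertEverywhere x w)
  insertions-↭ x []      = ↭-refl ∷ []
  insertions-↭ x (y ∷ w) = ↭-refl ∷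
    All.map⁺ (All.map (λ p → ↭-trans (↭-prep y p) (↭-swap y x ↭-refl)) (insertions-↭ x w))

  Φ : (List A → ℤ) → List A → ℤ
  Φ φ S = ∑ (permutations S) φ

  Φ-∷ : ∀ φ x S → Φ φ (x ∷ S) ≡ Φ (insertions x φ) S
  Φ-∷ φ x S = ∑-concatMap (insertEverywhere x) (permutations S) φ

  Φ-cong : ∀ {φ χ} S → (∀ w → w ↭ S → φ w ≡ χ w) → Φ φ S ≡ Φ χ S
  Φ-cong []      h = cong (_+ 0ℤ) (h [] ↭-refl)
  Φ-cong {φ} {χ} (x ∷ S) h = begin
    Φ φ (x ∷ S)            ≡⟨ Φ-∷ φ x S ⟩
    Φ (insertions x φ) S   ≡⟨ Φ-cong S (λ w w↭S → ∑-congAll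
                                (All.map (λ {w′} p → h w′ (↭-trans p (↭-prep x w↭S))) (insertions-↭ x w))) ⟩
    Φ (insertions x χ) S   ≡⟨ sym (Φ-∷ χ x S) ⟩
    Φ χ (x ∷ S)            ∎

  -- A product rule: the inserted letter ends up in the left or in the right piece. The gap at the
  -- cut serves both pieces, which accounts for the additional cut of the longer word.
  insertions-cut : ∀ x ψ w → insertions x (cut ψ) w ≡
    cut (λ u v → insertions x (λ u′ → ψ u′ v) u) w + cut (λ u v → insertions x (ψ u) v) w
  insertions-cut x ψ []      = arrange (ψ [] (x ∷ [])) (ψ (x ∷ []) [])
    where
    arrange : ∀ a b → a + b + 0ℤ ≡ (b + 0ℤ) + (a + 0ℤ)
    arrange = solve-∀
  insertions-cut x ψ (y ∷ w) = begin
    insertions x (cut ψ) (y ∷ w)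
      ≡⟨ insertions-∷ x (cut ψ) y w ⟩
    ψ [] (x ∷ y ∷ w) + (ψ (x ∷ []) (y ∷ w) + cut (λ u → ψ (x ∷ y ∷ u)) w)
      + ∑ (insertEverywhere x w) (λ w′ → ψ [] (y ∷ w′) + cut (λ u → ψ (y ∷ u)) w′)
      ≡⟨ +-congˡ (ψ [] (x ∷ y ∷ w) + (ψ (x ∷ []) (y ∷ w) + cut (λ u → ψ (x ∷ y ∷ u)) w))
           (trans (∑-distrib-+ (insertEverywhere x w) _ _) (+-congˡ (insertions x (ψ [] ∘ (y ∷_)) w)
             (insertions-cut x (λ u → ψ (y ∷ u)) w))) ⟩
    ψ [] (x ∷ y ∷ w) + (ψ (x ∷ []) (y ∷ w) + cut (λ u → ψ (x ∷ y ∷ u)) w)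
      + (insertions x (ψ [] ∘ (y ∷_)) w +
          (cut (λ u v → insertions x (λ u′ → ψ (y ∷ u′) v) u) w + cut (λ u v → insertions x (ψ (y ∷ u)) v) w))
      ≡⟨ rearrange (ψ [] (x ∷ y ∷ w)) (ψ (x ∷ []) (y ∷ w)) _ _ _ _ ⟩
    ((ψ (x ∷ []) (y ∷ w) + 0ℤ) + (cut (λ u → ψ (x ∷ y ∷ u)) w + cut (λ u v → insertions x (λ u′ → ψ (y ∷ u′) v) u) w))
      + ((ψ [] (x ∷ y ∷ w) + insertions x (ψ [] ∘ (y ∷_)) w) + cut (λ u v → insertions x (ψ (y ∷ u)) v) w)
      ≡⟨ sym (cong₂ _+_
           (+-congˡ (ψ (x ∷ []) (y ∷ w) + 0ℤ) (trans (cut-cong w (λ u v _ → insertions-∷ x (λ u′ → ψ u′ v) y u)) (cut-distrib-+ _ _ w)))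
           (cong (_+ cut (λ u v → insertions x (ψ (y ∷ u)) v) w) (insertions-∷ x (ψ []) y w))) ⟩
    cut (λ u v → insertions x (λ u′ → ψ u′ v) u) (y ∷ w) + cut (λ u v → insertions x (ψ u) v) (y ∷ w) ∎
    where
    rearrange : ∀ a b c d e f → a + (b + c) + (d + (e + f)) ≡ ((b + 0ℤ) + (c + e)) + ((a + d) + f)
    rearrange = solve-∀

  -- Orderings are built by inserting the head of the list. By `insertions-cut` it joins either
  -- piece, exactly as in the recursion of `split`.
  Φ-cut : ∀ ψ S → Φ (cut ψ) S ≡ split (λ T U → Φ (λ u → Φ (ψ u) U) T) S
  Φ-cut ψ []      = sym (+-identityʳ _)
  Φ-cut ψ (x ∷ S) = begin
    Φ (cut ψ) (x ∷ S)
      ≡⟨ Φ-∷ (cut ψ) x S ⟩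
    Φ (insertions x (cut ψ)) S
      ≡⟨ trans (∑-cong (permutations S) (insertions-cut x ψ)) (∑-distrib-+ (permutations S) _ _) ⟩
    Φ (cut (λ u v → insertions x (λ u′ → ψ u′ v) u)) S + Φ (cut (λ u v → insertions x (ψ u) v)) S
      ≡⟨ cong₂ _+_ (Φ-cut _ S) (Φ-cut _ S) ⟩
    split (λ T U → Φ (λ u → Φ (λ v → insertions x (λ u′ → ψ u′ v) u) U) T) S
      + split (λ T U → Φ (λ u → Φ (insertions x (ψ u)) U) T) S
      ≡⟨ cong₂ _+_
           (split-cong S (λ {T} {U} _ → trans
             (∑-cong (permutations T) (λ u → ∑-swap (permutations U) (insertEverywhere x u) (λ v u′ → ψ u′ v)))
             (sym (Φ-∷ (λ u → Φ (ψ u) U) x T))))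
           (split-cong S (λ {T} {U} _ → ∑-cong (permutations T) (λ u → sym (Φ-∷ (ψ u) x U)))) ⟩
    split (λ T U → Φ (λ u → Φ (ψ u) U) T) (x ∷ S) ∎
    where
    ∑-swap : ∀ {B C : Set} (xs : List B) (ys : List C) (ψ : B → C → ℤ) → ∑ xs (λ x → ∑ ys (ψ x)) ≡ ∑ ys (λ y → ∑ xs (λ x → ψ x y))
    ∑-swap []       ys ψ = sym (∑-0 ys)
      where
      ∑-0 : ∀ {C : Set} (ys : List C) → ∑ ys (λ _ → 0ℤ) ≡ 0ℤ
      ∑-0 []       = refl
      ∑-0 (y ∷ ys) = trans (+-identityˡ _) (∑-0 ys)
    ∑-swap (x ∷ xs) ys ψ = trans (+-congˡ (∑ ys (ψ x)) (∑-swap xs ys ψ)) (sym (∑-distrib-+ ys _ _))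

  Φ-· : ∀ φ ψ → Φ (φ · ψ) ≗ Φ φ ⊛ Φ ψ
  Φ-· φ ψ S = trans (Φ-cut (λ u v → φ u * ψ v) S) (split-cong S λ {T} {U} _ → begin
    Φ (λ u → Φ (λ v → φ u * ψ v) U) T ≡⟨ ∑-cong (permutations T) (λ u → trans (*-distribˡ-∑ (φ u) (permutations U) ψ) (*-comm (φ u) _)) ⟩
    Φ (λ u → Φ ψ U * φ u) T           ≡⟨ *-distribˡ-∑ (Φ ψ U) (permutations T) φ ⟩
    Φ ψ U * Φ φ T                     ≡⟨ *-comm (Φ ψ U) _ ⟩
    Φ φ T * Φ ψ U                     ∎)

  -- Regroups the orderings, generated by insertion, by their first letter: `x` either comes first
  -- or is inserted behind another first letter. The set must be nonempty, since the empty word has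
  -- no first letter.
  Φ-pick : ∀ φ x S → Φ φ (x ∷ S) ≡ pick (λ y → Φ (φ ∘ (y ∷_))) (x ∷ S)
  Φ-pick φ x []      = arrange (φ (x ∷ []))
    where
    arrange : ∀ a → a + 0ℤ ≡ a + 0ℤ + 0ℤ
    arrange = solve-∀
  Φ-pick φ x (y ∷ S) = begin
    Φ φ (x ∷ y ∷ S)
      ≡⟨ Φ-∷ φ x (y ∷ S) ⟩
    Φ (insertions x φ) (y ∷ S)
      ≡⟨ Φ-pick (insertions x φ) y S ⟩
    pick (λ z → Φ (insertions x φ ∘ (z ∷_))) (y ∷ S)
      ≡⟨ pick-cong (y ∷ S) (λ z U _ → trans (∑-cong (permutations U) (insertions-∷ x φ z))
           (∑-distrib-+ (permutations U) _ _)) ⟩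
    pick (λ z U → Φ (φ ∘ (x ∷_) ∘ (z ∷_)) U + Φ (insertions x (φ ∘ (z ∷_))) U) (y ∷ S)
      ≡⟨ pick-distrib-+ (λ z → Φ (φ ∘ (x ∷_) ∘ (z ∷_))) (λ z → Φ (insertions x (φ ∘ (z ∷_)))) (y ∷ S) ⟩
    pick (λ z → Φ (φ ∘ (x ∷_) ∘ (z ∷_))) (y ∷ S) + pick (λ z → Φ (insertions x (φ ∘ (z ∷_)))) (y ∷ S)
      ≡⟨ cong₂ _+_ (sym (Φ-pick (φ ∘ (x ∷_)) y S)) (pick-cong (y ∷ S) (λ z U _ → sym (Φ-∷ (φ ∘ (z ∷_)) x U))) ⟩
    pick (λ z → Φ (φ ∘ (z ∷_))) (x ∷ y ∷ S) ∎

  insertions-length : ∀ x w → insertions x (λ _ → 1ℤ) w ≡ + suc (length w)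
  insertions-length x []      = refl
  insertions-length x (y ∷ w) = trans (insertions-∷ x (λ _ → 1ℤ) y w) (+-congˡ (1ℤ) (insertions-length x w))

  Φ-one : ∀ S → Φ (λ _ → 1ℤ) S ≡ + (length S !)
  Φ-one []      = refl
  Φ-one (x ∷ S) = begin
    Φ (λ _ → 1ℤ) (x ∷ S)                          ≡⟨ Φ-∷ (λ _ → 1ℤ) x S ⟩
    Φ (insertions x (λ _ → 1ℤ)) S                 ≡⟨ Φ-cong S (λ w w↭S → trans (insertions-length x w)
                                                       (trans (cong (λ n → + suc n) (↭-length w↭S)) (sym (*-identityʳ _)))) ⟩
    Φ (λ _ → + suc (length S) * 1ℤ) S             ≡⟨ *-distribˡ-∑ (+ suc (length S)) (permutations S) (λ _ → 1ℤ) ⟩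
    + suc (length S) * Φ (λ _ → 1ℤ) S             ≡⟨ cong (+ suc (length S) *_) (Φ-one S) ⟩
    + suc (length S) * + (length S !)             ≡⟨ sym (pos-* (suc (length S)) (length S !)) ⟩
    + (suc (length S) !)                          ∎

module _ {A : Set} where

  *-distribˡ-pick : ∀ k (ψ : A → List A → ℤ) S → pick (λ y U → k * ψ y U) S ≡ k * pick ψ S
  *-distribˡ-pick k ψ []      = sym (*-zeroʳ k)
  *-distribˡ-pick k ψ (x ∷ S) = trans (+-congˡ (k * ψ x S) (*-distribˡ-pick k _ S)) (sym (*-distribˡ-+ k (ψ x S) _))

  ⊛-scalarˡ : ∀ k (a b : List A → ℤ) S → ((λ T → k * a T) ⊛ b) S ≡ k * (a ⊛ b) S
  ⊛-scalarˡ k a b S = trans (split-cong S (λ {T} {U} _ → *-assoc k (a T) (b U))) (*-distribˡ-split k _ S)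

  ⊛-scalarʳ : ∀ k (a b : List A → ℤ) S → (a ⊛ (λ U → k * b U)) S ≡ k * (a ⊛ b) S
  ⊛-scalarʳ k a b S = trans (split-cong S (λ {T} {U} _ → *-swapˡ (a T) k (b U))) (*-distribˡ-split k _ S)

  ⊛-swapˡ : ∀ (a b c : List A → ℤ) → a ⊛ (b ⊛ c) ≗ b ⊛ (a ⊛ c)
  ⊛-swapˡ a b c S = begin
    (a ⊛ (b ⊛ c)) S ≡⟨ sym (⊛-assoc a b c S) ⟩
    (a ⊛ b ⊛ c) S   ≡⟨ ⊛-cong (⊛-comm a b) (λ _ → refl) S ⟩
    (b ⊛ a ⊛ c) S   ≡⟨ ⊛-assoc b a c S ⟩
    (b ⊛ (a ⊛ c)) S ∎

  -- Supports induction on size: a part of a splitting is not a structurally smaller list, but its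
  -- length is bounded.
  ⊛-congʳ-≤ : ∀ (a : List A → ℤ) {b b′} S → (∀ U → length U ℕ.≤ length S → b U ≡ b′ U) → (a ⊛ b) S ≡ (a ⊛ b′) S
  ⊛-congʳ-≤ a S h = split-cong S (λ {T} {U} i → cong (a T *_)
    (h U (subst (length U ℕ.≤_) (sym (interleave-length i)) (ℕ.m≤n+m (length U) (length T)))))

  D : (List A → ℤ) → List A → ℤ
  D a S = + length S * a S

  D-⊛ : ∀ a b S → D (a ⊛ b) S ≡ (D a ⊛ b) S + (a ⊛ D b) S
  D-⊛ a b S = begin
    + length S * (a ⊛ b) S
      ≡⟨ sym (*-distribˡ-split (+ length S) _ S) ⟩
    split (λ T U → + length S * (a T * b U)) S
      ≡⟨ split-cong S (λ {T} {U} i → trans (cong (λ n → + n * (a T * b U)) (interleave-length i))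
           (leibniz (+ length T) (+ length U) (a T) (b U))) ⟩
    split (λ T U → + length T * a T * b U + a T * (+ length U * b U)) S
      ≡⟨ split-distrib-+ (λ T U → D a T * b U) (λ T U → a T * D b U) S ⟩
    (D a ⊛ b) S + (a ⊛ D b) S ∎
    where
    leibniz : ∀ m n x y → (m + n) * (x * y) ≡ m * x * y + x * (n * y)
    leibniz = solve-∀

  -- Set partitions with a marked block

  -- Either the block that `x` joined is the marked one, or `x` joined one of the remaining blocks.
  ∑-insertIntoBlock-pick : ∀ x φ (p : List (List A)) →
    ∑ (insertIntoBlock x p) (pick φ) ≡ pick (λ b r → φ (x ∷ b) r + ∑ (insertIntoBlock x r) (φ b)) p
  ∑-insertIntoBlock-pick x φ []      = refl
  ∑-insertIntoBlock-pick x φ (b ∷ p) = begin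
    φ (x ∷ b) p + pick (λ b′ r → φ b′ ((x ∷ b) ∷ r)) p + ∑ (map (b ∷_) (insertIntoBlock x p)) (pick φ)
      ≡⟨ +-congˡ (φ (x ∷ b) p + pick (λ b′ r → φ b′ ((x ∷ b) ∷ r)) p) (trans (∑-map (b ∷_) (insertIntoBlock x p) (pick φ))
           (trans (∑-distrib-+ (insertIntoBlock x p) (φ b) (pick (λ b′ r → φ b′ (b ∷ r))))
             (+-congˡ (∑ (insertIntoBlock x p) (φ b)) (∑-insertIntoBlock-pick x (λ b′ r → φ b′ (b ∷ r)) p)))) ⟩
    φ (x ∷ b) p + pick (λ b′ r → φ b′ ((x ∷ b) ∷ r)) p
      + (∑ (insertIntoBlock x p) (φ b) + pick (λ b′ r → φ (x ∷ b′) (b ∷ r) + ∑ (insertIntoBlock x r) (λ r′ → φ b′ (b ∷ r′))) p)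
      ≡⟨ +-congˡ (φ (x ∷ b) p + pick (λ b′ r → φ b′ ((x ∷ b) ∷ r)) p)
           (+-congˡ (∑ (insertIntoBlock x p) (φ b)) (pick-distrib-+ _ _ p)) ⟩
    φ (x ∷ b) p + pick (λ b′ r → φ b′ ((x ∷ b) ∷ r)) p
      + (∑ (insertIntoBlock x p) (φ b) + (pick (λ b′ r → φ (x ∷ b′) (b ∷ r)) p + pick (λ b′ r → ∑ (insertIntoBlock x r) (λ r′ → φ b′ (b ∷ r′))) p))
      ≡⟨ rearrange (φ (x ∷ b) p) _ (∑ (insertIntoBlock x p) (φ b))
           (pick (λ b′ r → φ (x ∷ b′) (b ∷ r)) p) _ ⟩
    φ (x ∷ b) p + ∑ (insertIntoBlock x p) (φ b) + (pick (λ b′ r → φ (x ∷ b′) (b ∷ r)) p +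
      (pick (λ b′ r → φ b′ ((x ∷ b) ∷ r)) p + pick (λ b′ r → ∑ (insertIntoBlock x r) (λ r′ → φ b′ (b ∷ r′))) p))
      ≡⟨ +-congˡ (φ (x ∷ b) p + ∑ (insertIntoBlock x p) (φ b)) (trans
           (+-congˡ (pick (λ b′ r → φ (x ∷ b′) (b ∷ r)) p) (sym (pick-distrib-+ _ _ p)))
           (trans (sym (pick-distrib-+ _ _ p)) (pick-cong p (λ b′ r _ → +-congˡ (φ (x ∷ b′) (b ∷ r))
             (+-congˡ (φ b′ ((x ∷ b) ∷ r)) (sym (∑-map (b ∷_) (insertIntoBlock x r) (φ b′)))))))) ⟩
    pick (λ b′ r → φ (x ∷ b′) r + ∑ (insertIntoBlock x r) (φ b′)) (b ∷ p) ∎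
    where
    rearrange : ∀ a b c d e → a + b + (c + (d + e)) ≡ a + c + (d + (b + e))
    rearrange = solve-∀

  -- Marking a possibly empty block T of a set partition amounts to splitting
  -- off T and partitioning the rest.
  ∑-setPartitions-pick : ∀ (φ : List A → List (List A) → ℤ) S →
    ∑ (setPartitions S) (λ p → φ [] p + pick φ p) ≡ split (λ T U → ∑ (setPartitions U) (φ T)) S
  ∑-setPartitions-pick φ []      = cong (_+ 0ℤ) (+-identityʳ (φ [] []))
  ∑-setPartitions-pick φ (x ∷ S) = begin
    ∑ (setPartitions (x ∷ S)) (λ p → φ [] p + pick φ p)
      ≡⟨ ∑-concatMap (λ p → ((x ∷ []) ∷ p) ∷ insertIntoBlock x p) (setPartitions S) _ ⟩
    ∑ (setPartitions S) (λ p → φ [] ((x ∷ []) ∷ p) + (φ (x ∷ []) p + pick (λ b r → φ b ((x ∷ []) ∷ r)) p)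
      + ∑ (insertIntoBlock x p) (λ p → φ [] p + pick φ p))
      ≡⟨ ∑-cong (setPartitions S) (λ p → begin
           φ [] ((x ∷ []) ∷ p) + (φ (x ∷ []) p + pick (λ b r → φ b ((x ∷ []) ∷ r)) p)
             + ∑ (insertIntoBlock x p) (λ p → φ [] p + pick φ p)
             ≡⟨ +-congˡ (φ [] ((x ∷ []) ∷ p) + (φ (x ∷ []) p + pick (λ b r → φ b ((x ∷ []) ∷ r)) p))
                  (trans (∑-distrib-+ (insertIntoBlock x p) (φ []) (pick φ))
                    (+-congˡ (∑ (insertIntoBlock x p) (φ []))
                      (trans (∑-insertIntoBlock-pick x φ p) (pick-distrib-+ _ _ p)))) ⟩
           φ [] ((x ∷ []) ∷ p) + (φ (x ∷ []) p + pick (λ b r → φ b ((x ∷ []) ∷ r)) p)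
             + (∑ (insertIntoBlock x p) (φ []) + (pick (λ b → φ (x ∷ b)) p + pick (λ b r → ∑ (insertIntoBlock x r) (φ b)) p))
             ≡⟨ rearrange (φ [] ((x ∷ []) ∷ p)) (φ (x ∷ []) p) _ _ _ _ ⟩
           (φ (x ∷ []) p + pick (λ b → φ (x ∷ b)) p) + (φ [] ((x ∷ []) ∷ p) + ∑ (insertIntoBlock x p) (φ [])
             + (pick (λ b r → φ b ((x ∷ []) ∷ r)) p + pick (λ b r → ∑ (insertIntoBlock x r) (φ b)) p))
             ≡⟨ +-congˡ (φ (x ∷ []) p + pick (λ b → φ (x ∷ b)) p)
                  (+-congˡ (φ [] ((x ∷ []) ∷ p) + ∑ (insertIntoBlock x p) (φ [])) (sym (pick-distrib-+ _ _ p))) ⟩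
           (φ (x ∷ []) p + pick (λ b → φ (x ∷ b)) p) + (φ′ [] p + pick φ′ p) ∎) ⟩
    ∑ (setPartitions S) (λ p → (φ (x ∷ []) p + pick (λ b → φ (x ∷ b)) p) + (φ′ [] p + pick φ′ p))
      ≡⟨ ∑-distrib-+ (setPartitions S) _ _ ⟩
    ∑ (setPartitions S) (λ p → φ (x ∷ []) p + pick (λ b → φ (x ∷ b)) p) + ∑ (setPartitions S) (λ p → φ′ [] p + pick φ′ p)
      ≡⟨ cong₂ _+_ (∑-setPartitions-pick (λ b → φ (x ∷ b)) S) (∑-setPartitions-pick φ′ S) ⟩
    split (λ T U → ∑ (setPartitions U) (φ (x ∷ T))) S + split (λ T U → ∑ (setPartitions U) (φ′ T)) S
      ≡⟨ +-congˡ (split (λ T U → ∑ (setPartitions U) (φ (x ∷ T))) S) (split-cong S (λ {T} {U} _ →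
           sym (∑-concatMap (λ p → ((x ∷ []) ∷ p) ∷ insertIntoBlock x p) (setPartitions U) (φ T)))) ⟩
    split (λ T U → ∑ (setPartitions U) (φ T)) (x ∷ S) ∎
    where
    -- The case of `x` outside the marked block: a block of its own, or a member of another block.
    φ′ : List A → List (List A) → ℤ
    φ′ b r = φ b ((x ∷ []) ∷ r) + ∑ (insertIntoBlock x r) (φ b)
    rearrange : ∀ a b c d e f → a + (b + c) + (d + (e + f)) ≡ (b + e) + (a + d + (c + f))
    rearrange = solve-∀

-- Exponentials and Lagrange inversion

module Exponential {A : Set} (c : List A → ℤ) where

  weight : ℤ → List (List A) → ℤ
  weight k []      = 1ℤ
  weight k (b ∷ p) = k * c b * weight k p

  exp : ℤ → List A → ℤ
  exp k S = ∑ (setPartitions S) (weight k)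

  ∑-insertIntoBlock-weight : ∀ k x p →
    ∑ (insertIntoBlock x p) (weight k) ≡ pick (λ b r → k * c (x ∷ b) * weight k r) p
  ∑-insertIntoBlock-weight k x []      = refl
  ∑-insertIntoBlock-weight k x (b ∷ p) = +-congˡ (k * c (x ∷ b) * weight k p) (begin
    ∑ (map (b ∷_) (insertIntoBlock x p)) (weight k)
      ≡⟨ ∑-map (b ∷_) (insertIntoBlock x p) (weight k) ⟩
    ∑ (insertIntoBlock x p) (λ r → k * c b * weight k r)
      ≡⟨ *-distribˡ-∑ (k * c b) (insertIntoBlock x p) (weight k) ⟩
    k * c b * ∑ (insertIntoBlock x p) (weight k)
      ≡⟨ cong (k * c b *_) (∑-insertIntoBlock-weight k x p) ⟩
    k * c b * pick (λ b r → k * c (x ∷ b) * weight k r) p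
      ≡⟨ sym (*-distribˡ-pick (k * c b) _ p) ⟩
    pick (λ b′ r → k * c b * (k * c (x ∷ b′) * weight k r)) p
      ≡⟨ pick-cong p (λ b′ r _ → *-swapˡ (k * c b) (k * c (x ∷ b′)) (weight k r)) ⟩
    pick (λ b′ r → k * c (x ∷ b′) * weight k (b ∷ r)) p ∎)

  -- `c ∘ (x ∷_)` is the derivative of `c` in direction `x`, and this is the chain rule for e^(kc):
  -- split off the block that contains `x`.
  exp-∷ : ∀ k x S → exp k (x ∷ S) ≡ k * ((c ∘ (x ∷_)) ⊛ exp k) S
  exp-∷ k x S = begin
    exp k (x ∷ S)
      ≡⟨ ∑-concatMap (λ p → ((x ∷ []) ∷ p) ∷ insertIntoBlock x p) (setPartitions S) (weight k) ⟩
    ∑ (setPartitions S) (λ p → k * c (x ∷ []) * weight k p + ∑ (insertIntoBlock x p) (weight k))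
      ≡⟨ ∑-cong (setPartitions S) (λ p → +-congˡ (k * c (x ∷ []) * weight k p) (∑-insertIntoBlock-weight k x p)) ⟩
    ∑ (setPartitions S) (λ p → k * c (x ∷ []) * weight k p + pick (λ b r → k * c (x ∷ b) * weight k r) p)
      -- The singleton block of `x` is the case of an empty marked block.
      ≡⟨ ∑-setPartitions-pick (λ b r → k * c (x ∷ b) * weight k r) S ⟩
    split (λ T U → ∑ (setPartitions U) (λ r → k * c (x ∷ T) * weight k r)) S
      ≡⟨ split-cong S (λ {T} {U} _ → *-distribˡ-∑ (k * c (x ∷ T)) (setPartitions U) (weight k)) ⟩
    split (λ T U → k * c (x ∷ T) * exp k U) S
      ≡⟨ ⊛-scalarˡ k (c ∘ (x ∷_)) (exp k) S ⟩
    k * ((c ∘ (x ∷_)) ⊛ exp k) S ∎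

  ⊛-exp-∷ : ∀ a l x S → split (λ T U → a T * exp l (x ∷ U)) S ≡ l * ((c ∘ (x ∷_)) ⊛ (a ⊛ exp l)) S
  ⊛-exp-∷ a l x S = begin
    split (λ T U → a T * exp l (x ∷ U)) S              ≡⟨ split-cong S (λ {T} {U} _ → cong (a T *_) (exp-∷ l x U)) ⟩
    (a ⊛ (λ U → l * ((c ∘ (x ∷_)) ⊛ exp l) U)) S       ≡⟨ ⊛-scalarʳ l a _ S ⟩
    l * (a ⊛ ((c ∘ (x ∷_)) ⊛ exp l)) S                 ≡⟨ cong (l *_) (⊛-swapˡ a (c ∘ (x ∷_)) (exp l) S) ⟩
    l * ((c ∘ (x ∷_)) ⊛ (a ⊛ exp l)) S                 ∎

  -- Both sides agree at `[]` and satisfy the same equation in direction `x`: in the product rule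
  -- the factors `k` and `l` add up.
  exp-+ : ∀ k l → exp k ⊛ exp l ≗ exp (k + l)
  exp-+ k l S = bounded (length S) S ℕ.≤-refl
    where
    bounded : ∀ n S → length S ℕ.≤ n → (exp k ⊛ exp l) S ≡ exp (k + l) S
    bounded n       []      _ = refl
    bounded (suc n) (x ∷ S) (ℕ.s≤s le) = begin
      split (λ T U → exp k (x ∷ T) * exp l U) S + split (λ T U → exp k T * exp l (x ∷ U)) S
        ≡⟨ cong₂ _+_ (trans (split-cong S (λ {T} {U} _ → cong (_* exp l U) (exp-∷ k x T)))
             (trans (⊛-scalarˡ k _ (exp l) S) (cong (k *_) (⊛-assoc (c ∘ (x ∷_)) (exp k) (exp l) S))))
             (⊛-exp-∷ (exp k) l x S) ⟩
      k * ((c ∘ (x ∷_)) ⊛ (exp k ⊛ exp l)) S + l * ((c ∘ (x ∷_)) ⊛ (exp k ⊛ exp l)) S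
        ≡⟨ sym (*-distribʳ-+ (((c ∘ (x ∷_)) ⊛ (exp k ⊛ exp l)) S) k l) ⟩
      (k + l) * ((c ∘ (x ∷_)) ⊛ (exp k ⊛ exp l)) S
        ≡⟨ cong ((k + l) *_) (⊛-congʳ-≤ (c ∘ (x ∷_)) S (λ U U≤S → bounded n U (ℕ.≤-trans U≤S le))) ⟩
      (k + l) * ((c ∘ (x ∷_)) ⊛ exp (k + l)) S
        ≡⟨ sym (exp-∷ (k + l) x S) ⟩
      exp (k + l) (x ∷ S) ∎

  exp-0 : exp 0ℤ ≗ 𝟙
  exp-0 []      = refl
  exp-0 (x ∷ S) = exp-∷ 0ℤ x S

  -- Writing ∂ for the derivative in direction `x`, prepending `x` adds one to the size, so ∂ D = (1
  -- + D) ∂. This reduces the claim at `x ∷ S` to `exp-∷`, the product rule for `D` and smaller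
  -- sets.
  D-exp : ∀ k S → D (exp k) S ≡ k * (D c ⊛ exp k) S
  D-exp k S = bounded (length S) S ℕ.≤-refl
    where
    bounded : ∀ n S → length S ℕ.≤ n → D (exp k) S ≡ k * (D c ⊛ exp k) S
    bounded n       []      _ = sym (*-zeroʳ k)
    bounded (suc n) (x ∷ S) (ℕ.s≤s le) = begin
      (1ℤ + + length S) * exp k (x ∷ S)
        ≡⟨ cong ((1ℤ + + length S) *_) (exp-∷ k x S) ⟩
      (1ℤ + + length S) * (k * (cₓ ⊛ exp k) S)
        ≡⟨ distrib (+ length S) k ((cₓ ⊛ exp k) S) ⟩
      k * ((cₓ ⊛ exp k) S + D (cₓ ⊛ exp k) S)
        ≡⟨ cong (λ z → k * ((cₓ ⊛ exp k) S + z)) (trans (D-⊛ cₓ (exp k) S)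
             (+-congˡ ((D cₓ ⊛ exp k) S) (trans (⊛-congʳ-≤ cₓ S (λ U U≤S → bounded n U (ℕ.≤-trans U≤S le)))
               (⊛-scalarʳ k cₓ _ S)))) ⟩
      k * ((cₓ ⊛ exp k) S + ((D cₓ ⊛ exp k) S + k * (cₓ ⊛ (D c ⊛ exp k)) S))
        ≡⟨ cong (k *_) (trans (sym (+-assoc ((cₓ ⊛ exp k) S) _ _)) (cong₂ _+_
             (sym (trans (split-cong S (λ {T} {U} _ → cong (_* exp k U) (unfold (+ length T) (cₓ T))))
               (⊛-distribʳ-+ (exp k) cₓ (D cₓ) S)))
             (sym (⊛-exp-∷ (D c) k x S)))) ⟩
      k * (split (λ T U → D c (x ∷ T) * exp k U) S + split (λ T U → D c T * exp k (x ∷ U)) S) ∎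
      where
      cₓ = c ∘ (x ∷_)
      distrib : ∀ n k a → (1ℤ + n) * (k * a) ≡ k * (a + n * a)
      distrib = solve-∀
      unfold : ∀ n a → (1ℤ + n) * a ≡ a + n * a
      unfold = solve-∀

  -- Since `D c` vanishes at `[]`, the right side at a nonempty `S` involves `a` only on smaller
  -- sets, and the factor `length S` on the left can be cancelled.
  exp-unique : ∀ a → a [] ≡ 1ℤ → (∀ S → D a S ≡ (D c ⊛ a) S) → a ≗ exp 1ℤ
  exp-unique a a[] Da S = bounded (length S) S ℕ.≤-refl
    where
    bounded : ∀ n S → length S ℕ.≤ n → a S ≡ exp 1ℤ S
    bounded n       []      _ = a[]
    bounded (suc n) (x ∷ S) (ℕ.s≤s le) = *-cancelˡ-≡ (+ suc (length S)) _ _ (begin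
      D a (x ∷ S)              ≡⟨ Da (x ∷ S) ⟩
      (D c ⊛ a) (x ∷ S)        ≡⟨ split-cong (x ∷ S) (λ {T} {U} i → smaller T U (interleave-length i)) ⟩
      (D c ⊛ exp 1ℤ) (x ∷ S)   ≡⟨ sym (*-identityˡ _) ⟩
      1ℤ * (D c ⊛ exp 1ℤ) (x ∷ S) ≡⟨ sym (D-exp 1ℤ (x ∷ S)) ⟩
      D (exp 1ℤ) (x ∷ S)       ∎)
      where
      smaller : ∀ T U → suc (length S) ≡ length T ℕ.+ length U → D c T * a U ≡ D c T * exp 1ℤ U
      smaller []      U eq = refl
      smaller (y ∷ T) U eq = cong (D c (y ∷ T) *_) (bounded n U
        (ℕ.≤-trans (ℕ.≤-trans (ℕ.m≤n+m (length U) (length T)) (ℕ.≤-reflexive (sym (ℕ.suc-injective eq)))) le))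

  -- The vanishing of residues behind Lagrange inversion.
  residue : ∀ S → let k = - + length S in exp k S + (D c ⊛ exp k) S ≡ 𝟙 S
  residue []      = refl
  residue (x ∷ S) = *-cancelˡ-≡ n _ _ (begin
    n * (exp (- n) (x ∷ S) + (D c ⊛ exp (- n)) (x ∷ S))
      ≡⟨ expand n (exp (- n) (x ∷ S)) ((D c ⊛ exp (- n)) (x ∷ S)) ⟩
    D (exp (- n)) (x ∷ S) - - n * (D c ⊛ exp (- n)) (x ∷ S)
      ≡⟨ cong (_- - n * (D c ⊛ exp (- n)) (x ∷ S)) (D-exp (- n) (x ∷ S)) ⟩
    - n * (D c ⊛ exp (- n)) (x ∷ S) - - n * (D c ⊛ exp (- n)) (x ∷ S)
      ≡⟨ +-inverseʳ (- n * (D c ⊛ exp (- n)) (x ∷ S)) ⟩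
    0ℤ
      ≡⟨ sym (*-zeroʳ n) ⟩
    n * 0ℤ ∎)
    where
    n = + suc (length S)
    expand : ∀ n a b → n * (a + b) ≡ n * a - - n * b
    expand = solve-∀

  -- Let t record size and put u = t e^c. The hypothesis says e^c = 1 + F(u), where `T` contributes
  -- F(T) u^|T|. Apply `D` and multiply by e^(-nc). The right side collapses to n F at the full set
  -- because residues vanish. The left side is D c ⊛ e^((1-n)c), and 1 - n times it is n e^((1-n)c)
  -- by `D-exp`.
  lagrange : ∀ F → (∀ S → exp 1ℤ S ≡ 𝟙 S + split (λ T U → F T * exp (+ length T) U) S) →
    ∀ x S → let n = + suc (length S) in (1ℤ - n) * F (x ∷ S) ≡ exp (1ℤ - n) (x ∷ S)
  lagrange F eq x S = *-cancelˡ-≡ n _ _ (begin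
    n * ((1ℤ - n) * F xS)
      ≡⟨ *-swapˡ n (1ℤ - n) (F xS) ⟩
    (1ℤ - n) * (n * F xS)
      ≡⟨ cong ((1ℤ - n) *_) (trans (sym viaΓ) viaExp) ⟩
    (1ℤ - n) * (D c ⊛ exp (1ℤ - n)) xS
      ≡⟨ sym (D-exp (1ℤ - n) xS) ⟩
    n * exp (1ℤ - n) xS ∎)
    where
    xS = x ∷ S
    n = + suc (length S)

    viaExp : (D (exp 1ℤ) ⊛ exp (- n)) xS ≡ (D c ⊛ exp (1ℤ - n)) xS
    viaExp = begin
      (D (exp 1ℤ) ⊛ exp (- n)) xS         ≡⟨ ⊛-cong {b = exp (- n)} (λ T → trans (D-exp 1ℤ T) (*-identityˡ _)) (λ _ → refl) xS ⟩
      (D c ⊛ exp 1ℤ ⊛ exp (- n)) xS       ≡⟨ ⊛-assoc (D c) (exp 1ℤ) (exp (- n)) xS ⟩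
      (D c ⊛ (exp 1ℤ ⊛ exp (- n))) xS     ≡⟨ ⊛-cong {a = D c} (λ _ → refl) (exp-+ 1ℤ (- n)) xS ⟩
      (D c ⊛ exp (1ℤ - n)) xS             ∎

    -- This is (1 + D c) ⊛ e^(mc). Multiplied by m it is the derivative of u^m, up to the power of
    -- t, so no division by m is needed.
    G : ℕ → List A → ℤ
    G m U = exp (+ m) U + (D c ⊛ exp (+ m)) U

    DΓ : ∀ R → D (exp 1ℤ) R ≡ split (λ T U → D F T * G (length T) U) R
    DΓ R = begin
      + length R * exp 1ℤ R
        ≡⟨ cong (+ length R *_) (eq R) ⟩
      + length R * (𝟙 R + split (λ T U → F T * exp (+ length T) U) R)
        ≡⟨ trans (*-distribˡ-+ (+ length R) (𝟙 R) _) (cong (_+ + length R * split (λ T U → F T * exp (+ length T) U) R) (D𝟙 R)) ⟩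
      0ℤ + + length R * split (λ T U → F T * exp (+ length T) U) R
        ≡⟨ trans (+-identityˡ _) (sym (*-distribˡ-split (+ length R) _ R)) ⟩
      split (λ T U → + length R * (F T * exp (+ length T) U)) R
        ≡⟨ split-cong R (λ {T} {U} i → begin
             + length R * (F T * exp (+ length T) U)
               ≡⟨ cong (λ m → + m * (F T * exp (+ length T) U)) (interleave-length i) ⟩
             (+ length T + + length U) * (F T * exp (+ length T) U)
               ≡⟨ expand (+ length T) (+ length U) (F T) (exp (+ length T) U) ⟩
             F T * (+ length T * exp (+ length T) U + D (exp (+ length T)) U)
               ≡⟨ cong (λ z → F T * (+ length T * exp (+ length T) U + z)) (D-exp (+ length T) U) ⟩
             F T * (+ length T * exp (+ length T) U + + length T * (D c ⊛ exp (+ length T)) U)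
               ≡⟨ factor (F T) (+ length T) (exp (+ length T) U) _ ⟩
             D F T * G (length T) U ∎) ⟩
      split (λ T U → D F T * G (length T) U) R ∎
      where
      D𝟙 : ∀ R → D 𝟙 R ≡ 0ℤ
      D𝟙 []      = refl
      D𝟙 (_ ∷ R) = *-zeroʳ (+ suc (length R))
      expand : ∀ m l f e → (m + l) * (f * e) ≡ f * (m * e + l * e)
      expand = solve-∀
      factor : ∀ f m a b → f * (m * a + m * b) ≡ m * f * (a + b)
      factor = solve-∀

    G-exp : ∀ m k R → (G m ⊛ exp k) R ≡ exp (+ m + k) R + (D c ⊛ exp (+ m + k)) R
    G-exp m k R = trans (⊛-distribʳ-+ (exp k) (exp (+ m)) (D c ⊛ exp (+ m)) R)
      (cong₂ _+_ (exp-+ (+ m) k R) (trans (⊛-assoc (D c) (exp (+ m)) (exp k) R)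
        (⊛-cong {a = D c} (λ _ → refl) (exp-+ (+ m) k) R)))

    viaΓ : (D (exp 1ℤ) ⊛ exp (- n)) xS ≡ n * F xS
    viaΓ = begin
      (D (exp 1ℤ) ⊛ exp (- n)) xS
        ≡⟨ split-cong xS (λ {R} {V} _ → trans (cong (_* exp (- n) V) (DΓ R)) (trans (*-comm _ (exp (- n) V))
             (trans (sym (*-distribˡ-split (exp (- n) V) _ R)) (split-cong R (λ {T} {U} _ →
               trans (*-comm (exp (- n) V) _) (*-assoc (D F T) (G (length T) U) (exp (- n) V))))))) ⟩
      split (λ R V → split (λ T U → D F T * (G (length T) U * exp (- n) V)) R) xS
        ≡⟨ split-assoc (λ T U V → D F T * (G (length T) U * exp (- n) V)) xS ⟩
      split (λ T R → split (λ U V → D F T * (G (length T) U * exp (- n) V)) R) xS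
        -- The exponent left on the complement `R` of `T` is |T| - n = -|R|, which is the one for
        -- which `residue` applies.
        ≡⟨ split-cong xS (λ {T} {R} i → trans (*-distribˡ-split (D F T) _ R) (cong (D F T *_)
             (trans (G-exp (length T) (- n) R) (trans (cong (λ k → exp k R + (D c ⊛ exp k) R) (complement T R (interleave-length i)))
               (residue R))))) ⟩
      (D F ⊛ 𝟙) xS
        ≡⟨ trans (⊛-comm (D F) 𝟙 xS) (⊛-identityˡ (D F) xS) ⟩
      n * F xS ∎
      where
      cancel : ∀ a b → a + - (a + b) ≡ - b
      cancel = solve-∀
      complement : ∀ (T R : List A) → suc (length S) ≡ length T ℕ.+ length R → + length T - n ≡ - + length R
      complement T R e = trans (cong (λ m → + length T - + m) e) (cancel (+ length T) (+ length R))

-- Walks and their decompositions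

module Walks (G : OrdAbGroup) {A : Set} (wt : A → OrdAbGroup.Carrier G) where

  open OrdAbGroup G using (Carrier; 0#; _<ᵍ_; Σ[_]; isAbelianGroup; isStrictTotalOrder)
    renaming (_+_ to _⊕_; +-monoʳ-< to ⊕-monoˡ-<)
  open IsStrictTotalOrder isStrictTotalOrder using (compare) renaming (trans to <ᵍ-trans)
  open IsAbelianGroup isAbelianGroup using ()
    renaming (assoc to ⊕-assoc; identityˡ to ⊕-identityˡ; identityʳ to ⊕-identityʳ)

  wsum : List A → Carrier
  wsum w = Σ[ map wt w ]

  wsum-++ : ∀ u v → wsum (u ++ v) ≡ wsum u ⊕ wsum v
  wsum-++ []      v = sym (⊕-identityˡ (wsum v))
  wsum-++ (x ∷ u) v = trans (cong (wt x ⊕_) (wsum-++ u v)) (sym (⊕-assoc (wt x) (wsum u) (wsum v)))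

  pos⇒< : ∀ {h} s → 0# <ᵍ h → s <ᵍ h ⊕ s
  pos⇒< {h} s p = subst (_<ᵍ h ⊕ s) (⊕-identityˡ s) (⊕-monoˡ-< s p)

  neg⇒> : ∀ {h} s → h <ᵍ 0# → h ⊕ s <ᵍ s
  neg⇒> {h} s p = subst (h ⊕ s <ᵍ_) (⊕-identityˡ s) (⊕-monoˡ-< s p)

  -- Case distinction by the sign of a height

  select : ∀ {P Q R : Set} → Tri P Q R → ℤ → ℤ → ℤ → ℤ
  select (tri< _ _ _) a b c = a
  select (tri≈ _ _ _) a b c = b
  select (tri> _ _ _) a b c = c

  sgn : Carrier → ℤ → ℤ → ℤ → ℤ
  sgn h = select (compare h 0#)

  sgn-neg : ∀ {h a b c} → h <ᵍ 0# → sgn h a b c ≡ a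
  sgn-neg {h} p with compare h 0#
  ... | tri< _ _ _ = refl
  ... | tri≈ ¬p _ _ = contradiction p ¬p
  ... | tri> ¬p _ _ = contradiction p ¬p

  sgn-zero : ∀ {h a b c} → h ≡ 0# → sgn h a b c ≡ b
  sgn-zero {h} p with compare h 0#
  ... | tri< _ ¬p _ = contradiction p ¬p
  ... | tri≈ _ _ _ = refl
  ... | tri> _ ¬p _ = contradiction p ¬p

  sgn-pos : ∀ {h a b c} → 0# <ᵍ h → sgn h a b c ≡ c
  sgn-pos {h} p with compare h 0#
  ... | tri< _ _ ¬p = contradiction p ¬p
  ... | tri≈ _ _ ¬p = contradiction p ¬p
  ... | tri> _ _ _ = refl

  sgn-const : ∀ h a → sgn h a a a ≡ a
  sgn-const h a with compare h 0#
  ... | tri< _ _ _ = refl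
  ... | tri≈ _ _ _ = refl
  ... | tri> _ _ _ = refl

  sgn-* : ∀ h a b c z → sgn h a b c * z ≡ sgn h (a * z) (b * z) (c * z)
  sgn-* h a b c z with compare h 0#
  ... | tri< _ _ _ = refl
  ... | tri≈ _ _ _ = refl
  ... | tri> _ _ _ = refl

  sgn-flip : ∀ {h s} a b c → h ⊕ s ≡ 0# → sgn h a b c ≡ sgn s c b a
  sgn-flip {h} {s} a b c eq with compare h 0#
  ... | tri< p _ _ = sym (sgn-pos (subst (_<ᵍ s) eq (neg⇒> s p)))
  ... | tri≈ _ refl _ = sym (sgn-zero (trans (sym (⊕-identityˡ s)) eq))
  ... | tri> _ _ p = sym (sgn-neg (subst (s <ᵍ_) eq (pos⇒< s p)))

  -- Indicators of properties of the walk from height h with steps wt x.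

  Dyck : Carrier → List A → ℤ
  Dyck h []      = sgn h 0ℤ 1ℤ 0ℤ
  Dyck h (x ∷ w) = sgn h 0ℤ (Dyck (h ⊕ wt x) w) (Dyck (h ⊕ wt x) w)

  FirstPassage : Carrier → List A → ℤ
  FirstPassage h []      = sgn h 0ℤ 1ℤ 0ℤ
  FirstPassage h (x ∷ w) = sgn h 0ℤ 0ℤ (FirstPassage (h ⊕ wt x) w)

  -- The end point is a strict minimum.
  Descent : List A → ℤ
  Descent []      = 1ℤ
  Descent (x ∷ w) = sgn (wt x ⊕ wsum w) (Descent w) 0ℤ 0ℤ

  WeakDescent : List A → ℤ
  WeakDescent []      = 1ℤ
  WeakDescent (x ∷ w) = sgn (wt x ⊕ wsum w) (WeakDescent w) (WeakDescent w) 0ℤ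

  AboveZero : Carrier → List A → ℤ
  AboveZero h []      = sgn h 0ℤ 0ℤ 1ℤ
  AboveZero h (x ∷ w) = sgn h 0ℤ 0ℤ (AboveZero (h ⊕ wt x) w)

  -- The starting point is a strict minimum.
  Ascent : List A → ℤ
  Ascent []      = 1ℤ
  Ascent (x ∷ w) = AboveZero (wt x) w

  -- The empty word is excluded so that cutting off a first excursion is a proper decomposition. A
  -- single letter of weight zero does count as an excursion.
  Excursion : List A → ℤ
  Excursion []      = 0ℤ
  Excursion (x ∷ w) = FirstPassage (wt x) w

  E : List A → ℤ
  E = Dyck 0#

  E-∷ : ∀ x w → E (x ∷ w) ≡ Dyck (wt x) w
  E-∷ x w = trans (sgn-zero refl) (cong (λ h → Dyck h w) (⊕-identityˡ (wt x)))

  Dyck-neg : ∀ {h} w → h <ᵍ 0# → Dyck h w ≡ 0ℤ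
  Dyck-neg []      p = sgn-neg p
  Dyck-neg (x ∷ w) p = sgn-neg p

  Dyck-sum : ∀ h w → Dyck h w ≡ 0ℤ ⊎ h ⊕ wsum w ≡ 0#
  Dyck-sum h [] with compare h 0#
  ... | tri< _ _ _ = inj₁ refl
  ... | tri≈ _ p _ = inj₂ (trans (⊕-identityʳ h) p)
  ... | tri> _ _ _ = inj₁ refl
  Dyck-sum h (x ∷ w) with compare h 0# | Dyck-sum (h ⊕ wt x) w
  ... | tri< _ _ _ | _      = inj₁ refl
  ... | tri≈ _ _ _ | inj₁ p = inj₁ p
  ... | tri> _ _ _ | inj₁ p = inj₁ p
  ... | _          | inj₂ p = inj₂ (trans (sym (⊕-assoc h (wt x) (wsum w))) p)

  -- Behind the indicator `Dyck h w`, a cofactor may be rewritten under the assumption that the walk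
  -- ends at 0.
  Dyck-cong : ∀ h w {y z} → (h ⊕ wsum w ≡ 0# → y ≡ z) → Dyck h w * y ≡ Dyck h w * z
  Dyck-cong h w {y} {z} f with Dyck-sum h w
  ... | inj₁ p = trans (cong (_* y) p) (cong (_* z) (sym p))
  ... | inj₂ p = cong (Dyck h w *_) (f p)

  E-cong : ∀ w {y z} → (wsum w ≡ 0# → y ≡ z) → E w * y ≡ E w * z
  E-cong w f = Dyck-cong 0# w (λ p → f (trans (sym (⊕-identityˡ (wsum w))) p))

  -- Translates a condition on the heights of prefixes into one on sums of suffixes: a walk that
  -- ends at 0 lies above 0 before its end exactly if its end is a strict minimum.
  FirstPassage-Descent : ∀ h w → FirstPassage h w ≡ sgn (h ⊕ wsum w) 0ℤ (Descent w) 0ℤ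
  FirstPassage-Descent h []      = cong (λ k → sgn k 0ℤ 1ℤ 0ℤ) (sym (⊕-identityʳ h))
  FirstPassage-Descent h (x ∷ w) = begin
    sgn h 0ℤ 0ℤ (FirstPassage (h ⊕ wt x) w)
      ≡⟨ cong (sgn h 0ℤ 0ℤ) (trans (FirstPassage-Descent (h ⊕ wt x) w)
           (cong (λ k → sgn k 0ℤ (Descent w) 0ℤ) (⊕-assoc h (wt x) (wsum w)))) ⟩
    sgn h 0ℤ 0ℤ (sgn (h ⊕ wsum (x ∷ w)) 0ℤ (Descent w) 0ℤ)
      ≡⟨ lemma h (wsum (x ∷ w)) (Descent w) ⟩
    sgn (h ⊕ wsum (x ∷ w)) 0ℤ (Descent (x ∷ w)) 0ℤ ∎
    where
    lemma : ∀ h s a → sgn h 0ℤ 0ℤ (sgn (h ⊕ s) 0ℤ a 0ℤ) ≡ sgn (h ⊕ s) 0ℤ (sgn s a 0ℤ 0ℤ) 0ℤ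
    lemma h s a with compare (h ⊕ s) 0#
    ... | tri< _ _ _ = sgn-const h 0ℤ
    ... | tri≈ _ p _ = sgn-flip 0ℤ 0ℤ a p
    ... | tri> _ _ _ = sgn-const h 0ℤ

  -- The only cut that contributes is the one at the first visit to 0.
  Dyck-firstPassage : ∀ h → Dyck h ≗ FirstPassage h · E
  Dyck-firstPassage h []      = sym (trans (cong (sgn h 0ℤ 1ℤ 0ℤ *_) (sgn-zero refl)) (*-identityʳ _))
  Dyck-firstPassage h (x ∷ w) with compare h 0#
  ... | tri< _ _ _ = sym (trans (+-identityˡ _) (cut-zero w))
  ... | tri≈ _ refl _ = sym (begin
    1ℤ * E (x ∷ w) + cut (λ u v → 0ℤ) w ≡⟨ cong₂ _+_ (*-identityˡ (E (x ∷ w))) (cut-zero w) ⟩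
    E (x ∷ w) + 0ℤ                      ≡⟨ +-identityʳ _ ⟩
    E (x ∷ w)                           ≡⟨ sgn-zero refl ⟩
    Dyck (0# ⊕ wt x) w                  ∎)
  ... | tri> _ _ _ = trans (Dyck-firstPassage (h ⊕ wt x) w) (sym (+-identityˡ _))

  E-firstReturn : ∀ w → E w ≡ 𝟙 w + (Excursion · E) w
  E-firstReturn []      = sgn-zero refl
  E-firstReturn (x ∷ w) = begin
    E (x ∷ w)                       ≡⟨ E-∷ x w ⟩
    Dyck (wt x) w                   ≡⟨ Dyck-firstPassage (wt x) w ⟩
    (FirstPassage (wt x) · E) w     ≡⟨ sym (trans (+-identityˡ _) (+-identityˡ _)) ⟩
    0ℤ + (0ℤ + (FirstPassage (wt x) · E) w) ∎

  -- If the end is a minimum, cut at the first point of that height: the walk before it is a strict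
  -- descent, and the rest is closed and stays nonnegative relative to its start.
  WeakDescent-Dyck : WeakDescent ≗ Descent · E
  WeakDescent-Dyck []      = sym (cong (1ℤ *_) (sgn-zero refl))
  WeakDescent-Dyck (x ∷ w) = sym (begin
    1ℤ * E (x ∷ w) + cut (λ u v → Descent (x ∷ u) * E v) w
      ≡⟨ cong (_+ cut (λ u v → Descent (x ∷ u) * E v) w) (trans (*-identityˡ _) (trans (E-∷ x w)
           (Dyck-firstPassage (wt x) w))) ⟩
    (FirstPassage (wt x) · E) w + cut (λ u v → Descent (x ∷ u) * E v) w
      ≡⟨ sym (cut-distrib-+ _ _ w) ⟩
    cut (λ u v → FirstPassage (wt x) u * E v + Descent (x ∷ u) * E v) w
      ≡⟨ cut-cong w (λ u v eq → begin
           FirstPassage (wt x) u * E v + Descent (x ∷ u) * E v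
             ≡⟨ sym (*-distribʳ-+ (E v) (FirstPassage (wt x) u) _) ⟩
           (FirstPassage (wt x) u + Descent (x ∷ u)) * E v
             -- The two indicators are the cases of equality and of strict inequality in one
             -- condition, `wt x ⊕ wsum u` being at most 0.
             ≡⟨ cong (_* E v) (trans (cong (_+ Descent (x ∷ u)) (FirstPassage-Descent (wt x) u)) (merge (wt x ⊕ wsum u) (Descent u))) ⟩
           sgn (wt x ⊕ wsum u) 1ℤ 1ℤ 0ℤ * Descent u * E v
             -- As `v` is closed, `u` and `w` have the same sum; the sign condition no longer
             -- depends on the cut and leaves the sum.
             ≡⟨ trans (*-comm _ (E v)) (E-cong v (λ p → cong (λ s → sgn (wt x ⊕ s) 1ℤ 1ℤ 0ℤ * Descent u) (begin
                  wsum u           ≡⟨ sym (⊕-identityʳ (wsum u)) ⟩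
                  wsum u ⊕ 0#      ≡⟨ cong (wsum u ⊕_) (sym p) ⟩
                  wsum u ⊕ wsum v  ≡⟨ sym (wsum-++ u v) ⟩
                  wsum (u ++ v)    ≡⟨ cong wsum eq ⟩
                  wsum w           ∎))) ⟩
           E v * (sgn (wt x ⊕ wsum w) 1ℤ 1ℤ 0ℤ * Descent u)
             ≡⟨ trans (*-swapˡ (E v) (sgn (wt x ⊕ wsum w) 1ℤ 1ℤ 0ℤ) (Descent u)) (cong (sgn (wt x ⊕ wsum w) 1ℤ 1ℤ 0ℤ *_) (*-comm (E v) (Descent u))) ⟩
           sgn (wt x ⊕ wsum w) 1ℤ 1ℤ 0ℤ * (Descent u * E v) ∎) ⟩
    cut (λ u v → sgn (wt x ⊕ wsum w) 1ℤ 1ℤ 0ℤ * (Descent u * E v)) w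
      ≡⟨ *-distribˡ-cut (sgn (wt x ⊕ wsum w) 1ℤ 1ℤ 0ℤ) _ w ⟩
    sgn (wt x ⊕ wsum w) 1ℤ 1ℤ 0ℤ * (Descent · E) w
      ≡⟨ cong (sgn (wt x ⊕ wsum w) 1ℤ 1ℤ 0ℤ *_) (sym (WeakDescent-Dyck w)) ⟩
    sgn (wt x ⊕ wsum w) 1ℤ 1ℤ 0ℤ * WeakDescent w
      ≡⟨ trans (sgn-* (wt x ⊕ wsum w) 1ℤ 1ℤ 0ℤ (WeakDescent w)) (cong (λ m → sgn (wt x ⊕ wsum w) m m 0ℤ) (*-identityˡ _)) ⟩
    WeakDescent (x ∷ w) ∎)
    where
    merge : ∀ h a → sgn h 0ℤ a 0ℤ + sgn h a 0ℤ 0ℤ ≡ sgn h 1ℤ 1ℤ 0ℤ * a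
    merge h a with compare h 0#
    ... | tri< _ _ _ = trans (+-identityˡ a) (sym (*-identityˡ a))
    ... | tri≈ _ _ _ = trans (+-identityʳ a) (sym (*-identityˡ a))
    ... | tri> _ _ _ = refl

  -- Imagine an extra point at height 0 in front of the walk. The last minimum of all points is
  -- either that point, and then the walk stays positive, or a point of the walk at height at most
  -- 0.
  lastMinimum-from : ∀ h w →
    cut (λ u v → sgn (h ⊕ wsum u) (WeakDescent u) (WeakDescent u) 0ℤ * Ascent v) w + AboveZero h w ≡ 1ℤ
  lastMinimum-from h [] rewrite ⊕-identityʳ h with compare h 0#
  ... | tri< _ _ _ = refl
  ... | tri≈ _ _ _ = refl
  ... | tri> _ _ _ = refl
  lastMinimum-from h (y ∷ w) rewrite ⊕-identityʳ h = trans
    (cong (λ z → sgn h 1ℤ 1ℤ 0ℤ * Ascent (y ∷ w) + z + AboveZero h (y ∷ w))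
      (cut-cong w (λ u v _ → cong (_* Ascent v) (clip h (wsum (y ∷ u)) (WeakDescent u)))))
    (byCases h (lastMinimum-from (wt y) w) (lastMinimum-from (h ⊕ wt y) w))
    where
    -- Both `h ⊕ s` and `s` must be at most 0. If `h` is at most 0 the second condition implies the
    -- first, otherwise the first implies the second.
    clip : ∀ h s m → sgn (h ⊕ s) (sgn s m m 0ℤ) (sgn s m m 0ℤ) 0ℤ ≡ select (compare h 0#) (sgn s m m 0ℤ) (sgn s m m 0ℤ) (sgn (h ⊕ s) m m 0ℤ)
    clip h s m with compare h 0#
    clip h s m | tri< p _ _ with compare s 0#
    ... | tri< q _ _ = sgn-neg (<ᵍ-trans (neg⇒> s p) q)
    ... | tri≈ _ refl _ = sgn-neg (neg⇒> s p)
    ... | tri> _ _ q = sgn-const (h ⊕ s) 0ℤ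
    clip h s m | tri≈ _ refl _ rewrite ⊕-identityˡ s with compare s 0#
    ... | tri< _ _ _ = refl
    ... | tri≈ _ _ _ = refl
    ... | tri> _ _ _ = refl
    clip h s m | tri> _ _ p with compare (h ⊕ s) 0#
    ... | tri< q _ _ = sgn-neg (<ᵍ-trans (pos⇒< s p) q)
    ... | tri≈ _ q _ = sgn-neg (subst (s <ᵍ_) q (pos⇒< s p))
    ... | tri> _ _ q = refl

    -- If `h` is at most 0, the first point of the walk replaces the extra point as reference
    -- (`low`); otherwise the reference stays at 0 (`high`).
    byCases : ∀ h →
      cut (λ u v → sgn (wt y ⊕ wsum u) (WeakDescent u) (WeakDescent u) 0ℤ * Ascent v) w + AboveZero (wt y) w ≡ 1ℤ →
      cut (λ u v → sgn (h ⊕ wt y ⊕ wsum u) (WeakDescent u) (WeakDescent u) 0ℤ * Ascent v) w + AboveZero (h ⊕ wt y) w ≡ 1ℤ →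
      sgn h 1ℤ 1ℤ 0ℤ * Ascent (y ∷ w)
        + cut (λ u v → sgn h (sgn (wsum (y ∷ u)) (WeakDescent u) (WeakDescent u) 0ℤ)
                             (sgn (wsum (y ∷ u)) (WeakDescent u) (WeakDescent u) 0ℤ)
                             (sgn (h ⊕ wsum (y ∷ u)) (WeakDescent u) (WeakDescent u) 0ℤ) * Ascent v) w
        + AboveZero h (y ∷ w) ≡ 1ℤ
    byCases h low high with compare h 0#
    ... | tri< _ _ _ = trans (reorder (AboveZero (wt y) w) _) low
      where
      reorder : ∀ a b → 1ℤ * a + b + 0ℤ ≡ b + a
      reorder = solve-∀
    ... | tri≈ _ _ _ = trans (reorder (AboveZero (wt y) w) _) low
      where
      reorder : ∀ a b → 1ℤ * a + b + 0ℤ ≡ b + a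
      reorder = solve-∀
    ... | tri> _ _ _ = trans (cong (_+ AboveZero (h ⊕ wt y) w) (trans (+-identityˡ _)
        (cut-cong w (λ u v _ → cong (λ k → sgn k (WeakDescent u) (WeakDescent u) 0ℤ * Ascent v) (sym (⊕-assoc h (wt y) (wsum u))))))) high

  lastMinimum : ∀ w → (WeakDescent · Ascent) w ≡ 1ℤ
  lastMinimum []      = refl
  lastMinimum (y ∷ w) = trans (reorder (AboveZero (wt y) w) _) (lastMinimum-from (wt y) w)
    where
    reorder : ∀ a b → 1ℤ * a + b ≡ b + a
    reorder = solve-∀

  -- Every cut of a first passage except the one at its end leaves a positive prefix and a strict
  -- descent. Conversely, such a cut of a walk ending at 0 makes it a first passage.
  marked-firstPassage : ∀ h w →
    sgn (h ⊕ wsum w) 0ℤ 1ℤ 0ℤ * (AboveZero h · Descent) w ≡ + length w * FirstPassage h w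
  marked-firstPassage h [] rewrite ⊕-identityʳ h with compare h 0#
  ... | tri< _ _ _ = refl
  ... | tri≈ _ _ _ = refl
  ... | tri> _ _ _ = refl
  marked-firstPassage h (x ∷ w) = byCases
    where
    step : sgn (h ⊕ wsum (x ∷ w)) 0ℤ 1ℤ 0ℤ * (AboveZero (h ⊕ wt x) · Descent) w ≡ + length w * FirstPassage (h ⊕ wt x) w
    step = trans (cong (λ k → sgn k 0ℤ 1ℤ 0ℤ * (AboveZero (h ⊕ wt x) · Descent) w) (sym (⊕-assoc h (wt x) (wsum w))))
      (marked-firstPassage (h ⊕ wt x) w)

    whole : 0# <ᵍ h → sgn (h ⊕ wsum (x ∷ w)) 0ℤ 1ℤ 0ℤ * Descent (x ∷ w) ≡ FirstPassage (h ⊕ wt x) w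
    whole p = begin
      sgn k 0ℤ 1ℤ 0ℤ * Descent (x ∷ w)                 ≡⟨ sgn-* k 0ℤ 1ℤ 0ℤ (Descent (x ∷ w)) ⟩
      sgn k 0ℤ (1ℤ * Descent (x ∷ w)) 0ℤ               ≡⟨ cong (λ z → sgn k 0ℤ z 0ℤ) (*-identityˡ _) ⟩
      sgn k 0ℤ (Descent (x ∷ w)) 0ℤ                    ≡⟨ sym (FirstPassage-Descent h (x ∷ w)) ⟩
      FirstPassage h (x ∷ w)                           ≡⟨ sgn-pos p ⟩
      FirstPassage (h ⊕ wt x) w                        ∎
      where k = h ⊕ wsum (x ∷ w)

    byCases : sgn (h ⊕ wsum (x ∷ w)) 0ℤ 1ℤ 0ℤ * (AboveZero h · Descent) (x ∷ w) ≡ + suc (length w) * FirstPassage h (x ∷ w)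
    byCases with compare h 0# | whole
    ... | tri< _ _ _ | _ = trans (cong (sgn (h ⊕ wsum (x ∷ w)) 0ℤ 1ℤ 0ℤ *_) (trans (+-identityˡ _) (cut-zero w)))
                             (trans (*-zeroʳ (sgn (h ⊕ wsum (x ∷ w)) 0ℤ 1ℤ 0ℤ)) (sym (*-zeroʳ (+ suc (length w)))))
    ... | tri≈ _ _ _ | _ = trans (cong (sgn (h ⊕ wsum (x ∷ w)) 0ℤ 1ℤ 0ℤ *_) (trans (+-identityˡ _) (cut-zero w)))
                             (trans (*-zeroʳ (sgn (h ⊕ wsum (x ∷ w)) 0ℤ 1ℤ 0ℤ)) (sym (*-zeroʳ (+ suc (length w)))))
    ... | tri> _ _ p | whole′ = begin
      k * (1ℤ * Descent (x ∷ w) + (AboveZero (h ⊕ wt x) · Descent) w)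
        ≡⟨ trans (*-distribˡ-+ k _ _) (cong (_+ k * (AboveZero (h ⊕ wt x) · Descent) w) (cong (k *_) (*-identityˡ (Descent (x ∷ w))))) ⟩
      k * Descent (x ∷ w) + k * (AboveZero (h ⊕ wt x) · Descent) w
        ≡⟨ cong₂ _+_ (whole′ p) step ⟩
      FirstPassage (h ⊕ wt x) w + + length w * FirstPassage (h ⊕ wt x) w
        ≡⟨ collect (+ length w) (FirstPassage (h ⊕ wt x) w) ⟩
      (1ℤ + + length w) * FirstPassage (h ⊕ wt x) w ∎
      where
      k = sgn (h ⊕ wsum (x ∷ w)) 0ℤ 1ℤ 0ℤ
      collect : ∀ n a → a + n * a ≡ (1ℤ + n) * a
      collect = solve-∀

  -- Strictness of `Ascent` and `Descent` rules out the two extreme cuts of an excursion, leaving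
  -- one cut fewer than letters; the term `Excursion w` fills the gap. The term `𝟙` is the cut of
  -- the empty word.
  marked-excursion : ∀ w → sgn (wsum w) 0ℤ 1ℤ 0ℤ * (Ascent · Descent) w + Excursion w ≡ 𝟙 w + D Excursion w
  marked-excursion []      = trans (+-identityʳ _) (trans (*-identityʳ _) (sgn-zero refl))
  marked-excursion (x ∷ w) = begin
    k * (1ℤ * Descent (x ∷ w) + (AboveZero (wt x) · Descent) w) + e
      ≡⟨ cong (_+ e) (*-distribˡ-+ k (1ℤ * Descent (x ∷ w)) _) ⟩
    k * (1ℤ * Descent (x ∷ w)) + k * (AboveZero (wt x) · Descent) w + e
      ≡⟨ cong (_+ e) (cong₂ _+_ (trans (cong (k *_) (*-identityˡ (Descent (x ∷ w)))) (vanish (wsum (x ∷ w)) (Descent w))) (marked-firstPassage (wt x) w)) ⟩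
    0ℤ + + length w * e + e
      ≡⟨ collect (+ length w) e ⟩
    0ℤ + (1ℤ + + length w) * e ∎
    where
    k = sgn (wsum (x ∷ w)) 0ℤ 1ℤ 0ℤ
    e = FirstPassage (wt x) w
    collect : ∀ n a → 0ℤ + n * a + a ≡ 0ℤ + (1ℤ + n) * a
    collect = solve-∀
    vanish : ∀ s a → sgn s 0ℤ 1ℤ 0ℤ * sgn s a 0ℤ 0ℤ ≡ 0ℤ
    vanish s a with compare s 0#
    ... | tri< _ _ _ = refl
    ... | tri≈ _ _ _ = refl
    ... | tri> _ _ _ = refl

  -- Excursion-free words and reduction by deleting nonnegative closed walks

  Hit : Carrier → List A → ℤ
  Hit h []      = sgn h 0ℤ 1ℤ 0ℤ
  Hit h (x ∷ w) = sgn h 0ℤ 1ℤ (Hit (h ⊕ wt x) w)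

  -- No factor of the word is an excursion.
  Free : List A → ℤ
  Free []      = 1ℤ
  Free (x ∷ w) = (1ℤ - Hit (wt x) w) * Free w

  -- Only the tail has to be free: a nonempty nonnegative closed walk always begins with an
  -- excursion, so the factors starting at the first letter are exempt.
  Tree : List A → ℤ
  Tree []      = 0ℤ
  Tree (x ∷ w) = Dyck (wt x) w * Free w

  Dyck⇒Hit : ∀ h w → Dyck h w * (1ℤ - Hit h w) ≡ 0ℤ
  Dyck⇒Hit h [] with compare h 0#
  ... | tri< _ _ _ = refl
  ... | tri≈ _ _ _ = refl
  ... | tri> _ _ _ = refl
  Dyck⇒Hit h (x ∷ w) with compare h 0#
  ... | tri< _ _ _ = refl
  ... | tri≈ _ _ _ = *-zeroʳ (Dyck (h ⊕ wt x) w)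
  ... | tri> _ _ _ = Dyck⇒Hit (h ⊕ wt x) w

  Hit-neg : ∀ {h} w → h <ᵍ 0# → Hit h w ≡ 0ℤ
  Hit-neg []      p = sgn-neg p
  Hit-neg (x ∷ w) p = sgn-neg p

  -- A walk that is negative after `u` has met or missed 0 within `u`.
  Hit-++ : ∀ h u v → h ⊕ wsum u <ᵍ 0# → Hit h (u ++ v) ≡ Hit h u
  Hit-++ h []      v p = trans (Hit-neg v p′) (sym (Hit-neg [] p′))
    where p′ = subst (_<ᵍ 0#) (⊕-identityʳ h) p
  Hit-++ h (x ∷ u) v p = cong (sgn h 0ℤ 1ℤ) (Hit-++ (h ⊕ wt x) u v (subst (_<ᵍ 0#) (sym (⊕-assoc h (wt x) (wsum u))) p))

  -- Cut at the first visit to 0. A Dyck walk that went on past this point would begin a further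
  -- excursion, so a free `u` leaves only this cut; and no excursion that starts in `u` can reach
  -- into `v`.
  Hit-Free : ∀ h w → Hit h w * Free w ≡ cut (λ u v → Dyck h u * Free u * Free v) w
  Hit-Free h []      = sym (*-identityʳ _)
  Hit-Free h (y ∷ w) with compare h 0#
  ... | tri< _ _ _ = sym (trans (+-identityˡ _) (cut-zero w))
  ... | tri≈ _ refl _ = sym (trans
      (+-congˡ (1ℤ * Free (y ∷ w)) (trans (cut-cong w (λ u v _ → cong (_* Free v) (begin
        Dyck (0# ⊕ wt y) u * ((1ℤ - Hit (wt y) u) * Free u)
          ≡⟨ cong (λ k → Dyck k u * ((1ℤ - Hit (wt y) u) * Free u)) (⊕-identityˡ (wt y)) ⟩
        Dyck (wt y) u * ((1ℤ - Hit (wt y) u) * Free u)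
          ≡⟨ sym (*-assoc (Dyck (wt y) u) _ (Free u)) ⟩
        Dyck (wt y) u * (1ℤ - Hit (wt y) u) * Free u
          ≡⟨ cong (_* Free u) (Dyck⇒Hit (wt y) u) ⟩
        0ℤ ∎))) (cut-zero w)))
      (+-identityʳ _))
  ... | tri> _ _ p = sym (begin
      0ℤ + cut (λ u v → Dyck (h ⊕ wt y) u * ((1ℤ - Hit (wt y) u) * Free u) * Free v) w
        ≡⟨ +-identityˡ _ ⟩
      cut (λ u v → Dyck (h ⊕ wt y) u * ((1ℤ - Hit (wt y) u) * Free u) * Free v) w
        ≡⟨ cut-cong w (λ u v eq → begin
             Dyck (h ⊕ wt y) u * ((1ℤ - Hit (wt y) u) * Free u) * Free v
               ≡⟨ *-assoc (Dyck (h ⊕ wt y) u) _ (Free v) ⟩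
             Dyck (h ⊕ wt y) u * ((1ℤ - Hit (wt y) u) * Free u * Free v)
               -- The letter `y` starts at height `h` above 0 and `u` ends at 0, so whether an
               -- excursion starts at `y` is decided inside `u`.
               ≡⟨ Dyck-cong (h ⊕ wt y) u (λ q → cong (λ z → (1ℤ - z) * Free u * Free v)
                    (trans (sym (Hit-++ (wt y) u v (below u q))) (cong (Hit (wt y)) eq))) ⟩
             Dyck (h ⊕ wt y) u * ((1ℤ - Hit (wt y) w) * Free u * Free v)
               ≡⟨ pull (Dyck (h ⊕ wt y) u) (1ℤ - Hit (wt y) w) (Free u) (Free v) ⟩
             (1ℤ - Hit (wt y) w) * (Dyck (h ⊕ wt y) u * Free u * Free v) ∎) ⟩
      cut (λ u v → (1ℤ - Hit (wt y) w) * (Dyck (h ⊕ wt y) u * Free u * Free v)) w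
        ≡⟨ *-distribˡ-cut (1ℤ - Hit (wt y) w) _ w ⟩
      (1ℤ - Hit (wt y) w) * cut (λ u v → Dyck (h ⊕ wt y) u * Free u * Free v) w
        ≡⟨ cong ((1ℤ - Hit (wt y) w) *_) (sym (Hit-Free (h ⊕ wt y) w)) ⟩
      (1ℤ - Hit (wt y) w) * (Hit (h ⊕ wt y) w * Free w)
        ≡⟨ *-swapˡ (1ℤ - Hit (wt y) w) (Hit (h ⊕ wt y) w) (Free w) ⟩
      Hit (h ⊕ wt y) w * ((1ℤ - Hit (wt y) w) * Free w) ∎)
      where
      below : ∀ u → h ⊕ wt y ⊕ wsum u ≡ 0# → wt y ⊕ wsum u <ᵍ 0#
      below u q = subst (wt y ⊕ wsum u <ᵍ_) (trans (sym (⊕-assoc h (wt y) (wsum u))) q) (pos⇒< (wt y ⊕ wsum u) p)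
      pull : ∀ d k a b → d * (k * a * b) ≡ k * (d * a * b)
      pull = solve-∀

  -- Putting `x` before a free word either keeps it free or creates an excursion at the front; then
  -- `Hit-Free` at height `wt x` cuts off a tree word.
  Free-∷ : ∀ x w → Free w ≡ Free (x ∷ w) + (Tree ∘ (x ∷_) · Free) w
  Free-∷ x w = trans (complement (Hit (wt x) w) (Free w)) (+-congˡ (Free (x ∷ w)) (Hit-Free (wt x) w))
    where
    complement : ∀ a b → b ≡ (1ℤ - a) * b + a * b
    complement = solve-∀

  -- sub α φ sums φ(x₁…xₘ) α(d₀) E(d₁) … E(dₘ) over all ways of writing the
  -- word as d₀ x₁ d₁ … xₘ dₘ.
  sub : (List A → ℤ) → (List A → ℤ) → List A → ℤ
  sub α φ []      = α [] * φ []
  sub α φ (x ∷ w) = α [] * sub E (φ ∘ (x ∷_)) w + sub (α ∘ (x ∷_)) φ w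

  -- No word is inserted before the first letter, so there are exactly as many gaps as letters.
  Λ : (List A → ℤ) → List A → ℤ
  Λ φ []      = φ []
  Λ φ (x ∷ w) = sub E (φ ∘ (x ∷_)) w

  sub-cong : ∀ {α β φ ψ} → α ≗ β → φ ≗ ψ → sub α φ ≗ sub β ψ
  sub-cong p q []      = cong₂ _*_ (p []) (q [])
  sub-cong p q (x ∷ w) = cong₂ _+_
    (cong₂ _*_ (p []) (sub-cong (λ _ → refl) (q ∘ (x ∷_)) w)) (sub-cong (p ∘ (x ∷_)) q w)

  sub-distrib-+ : ∀ α φ ψ w → sub α (λ t → φ t + ψ t) w ≡ sub α φ w + sub α ψ w
  sub-distrib-+ α φ ψ []      = *-distribˡ-+ (α []) _ _
  sub-distrib-+ α φ ψ (x ∷ w) = trans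
    (cong₂ _+_ (cong (α [] *_) (sub-distrib-+ E (φ ∘ (x ∷_)) (ψ ∘ (x ∷_)) w)) (sub-distrib-+ (α ∘ (x ∷_)) φ ψ w))
    (rearrange (α []) (sub E (φ ∘ (x ∷_)) w) _ _ _)
    where
    rearrange : ∀ a b c d e → a * (b + c) + (d + e) ≡ (a * b + d) + (a * c + e)
    rearrange = solve-∀

  sub-scalar : ∀ k α φ w → sub α (λ t → k * φ t) w ≡ k * sub α φ w
  sub-scalar k α φ []      = *-swapˡ (α []) k _
  sub-scalar k α φ (x ∷ w) = trans
    (cong₂ _+_ (trans (cong (α [] *_) (sub-scalar k E (φ ∘ (x ∷_)) w)) (*-swapˡ (α []) k _)) (sub-scalar k (α ∘ (x ∷_)) φ w))
    (sym (*-distribˡ-+ k (α [] * sub E (φ ∘ (x ∷_)) w) _))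

  sub-zeroˡ : ∀ φ w → sub (λ _ → 0ℤ) φ w ≡ 0ℤ
  sub-zeroˡ φ []      = refl
  sub-zeroˡ φ (x ∷ w) = trans (+-identityˡ _) (sub-zeroˡ φ w)

  -- Cutting the skeleton before a letter cuts the whole word before that letter. The preceding gap
  -- stays on the left, hence `Λ` on the right.
  sub-· : ∀ α φ ψ → sub α (φ · ψ) ≗ sub α φ · Λ ψ
  sub-· α φ ψ []      = sym (*-assoc (α []) (φ []) (ψ []))
  sub-· α φ ψ (x ∷ w) = begin
    α [] * sub E ((φ · ψ) ∘ (x ∷_)) w + sub (α ∘ (x ∷_)) (φ · ψ) w
      ≡⟨ cong₂ _+_ (cong (α [] *_) (trans (sub-distrib-+ E (λ t → φ [] * ψ (x ∷ t)) ((φ ∘ (x ∷_)) · ψ) w)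
           (cong₂ _+_ (sub-scalar (φ []) E (ψ ∘ (x ∷_)) w) (sub-· E (φ ∘ (x ∷_)) ψ w)))) (sub-· (α ∘ (x ∷_)) φ ψ w) ⟩
    α [] * (φ [] * Λ ψ (x ∷ w) + (sub E (φ ∘ (x ∷_)) · Λ ψ) w) + (sub (α ∘ (x ∷_)) φ · Λ ψ) w
      ≡⟨ rearrange (α []) (φ []) (Λ ψ (x ∷ w)) _ _ ⟩
    α [] * φ [] * Λ ψ (x ∷ w) + (α [] * (sub E (φ ∘ (x ∷_)) · Λ ψ) w + (sub (α ∘ (x ∷_)) φ · Λ ψ) w)
      ≡⟨ +-congˡ (α [] * φ [] * Λ ψ (x ∷ w)) (trans
           (cong (_+ (sub (α ∘ (x ∷_)) φ · Λ ψ) w) (sym (*-distribˡ-cut (α []) _ w)))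
           (trans (sym (cut-distrib-+ _ _ w)) (cut-cong w (λ u v _ → collect (α []) (sub E (φ ∘ (x ∷_)) u) _ (Λ ψ v))))) ⟩
    (sub α φ · Λ ψ) (x ∷ w) ∎
    where
    rearrange : ∀ a f l b c → a * (f * l + b) + c ≡ a * f * l + (a * b + c)
    rearrange = solve-∀
    collect : ∀ a b c l → a * (b * l) + c * l ≡ (a * b + c) * l
    collect = solve-∀

  sub-Λ : ∀ α φ → sub α φ ≗ α · Λ φ
  sub-Λ α φ []      = refl
  sub-Λ α φ (x ∷ w) = +-congˡ (α [] * Λ φ (x ∷ w)) (sub-Λ (α ∘ (x ∷_)) φ w)

  -- Inserting Dyck words into a walk does not change whether it is a Dyck walk.
  sub-Dyck : ∀ g h φ → ¬ (h <ᵍ 0#) → ∀ w →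
    sub (Dyck g) φ w * Dyck (h ⊕ g) w ≡ sub (Dyck g) (λ t → Dyck h t * φ t) w
  sub-Dyck g h φ h≥0 [] with compare g 0#
  ... | tri< _ _ _ = refl
  ... | tri≈ _ refl _ = trans (cong (λ k → 1ℤ * φ [] * Dyck k []) (⊕-identityʳ h)) (reorder (φ []) _)
    where
    reorder : ∀ a b → 1ℤ * a * b ≡ 1ℤ * (b * a)
    reorder = solve-∀
  ... | tri> _ _ _ = refl
  -- `h` is the height of the skeleton so far and `g` the height inside the current gap relative to
  -- it. The letter `x` continues the gap or, if `g` is 0, may be the next skeleton letter.
  sub-Dyck g h φ h≥0 (x ∷ w) = byCases
    where
    Dyck-∷ : ∀ {k} → ¬ (k <ᵍ 0#) → ∀ t → Dyck k (x ∷ t) ≡ Dyck (k ⊕ wt x) t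
    Dyck-∷ {k} k≥0 t with compare k 0#
    ... | tri< p _ _ = contradiction p k≥0
    ... | tri≈ _ _ _ = refl
    ... | tri> _ _ _ = refl

    g≥0⇒h⊕g≥0 : ¬ (g <ᵍ 0#) → ¬ (h ⊕ g <ᵍ 0#)
    g≥0⇒h⊕g≥0 g≥0 p with compare h 0#
    ... | tri< q _ _ = h≥0 q
    ... | tri≈ _ refl _ = g≥0 (subst (_<ᵍ 0#) (⊕-identityˡ g) p)
    ... | tri> _ _ q = g≥0 (<ᵍ-trans (pos⇒< g q) p)

    inGap : ¬ (g <ᵍ 0#) → sub (Dyck (g ⊕ wt x)) φ w * Dyck (h ⊕ g) (x ∷ w) ≡ sub (Dyck (g ⊕ wt x)) (λ t → Dyck h t * φ t) w
    inGap g≥0 = trans (cong (sub (Dyck (g ⊕ wt x)) φ w *_)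
        (trans (Dyck-∷ (g≥0⇒h⊕g≥0 g≥0) w) (cong (λ k → Dyck k w) (⊕-assoc h g (wt x)))))
      (sub-Dyck (g ⊕ wt x) h φ h≥0 w)

    φₓ = φ ∘ (x ∷_)

    atGap : sub E φₓ w * Dyck h (x ∷ w) ≡ sub E (λ t → Dyck h (x ∷ t) * φₓ t) w
    atGap = trans (cong (sub E φₓ w *_) (Dyck-∷ h≥0 w))
      (trans atGap′ (sub-cong (λ _ → refl) (λ t → cong (_* φₓ t) (sym (Dyck-∷ h≥0 t))) w))
      where
      -- A new gap opens at relative height 0. If the skeleton has become negative, both sides
      -- vanish instead.
      atGap′ : sub E φₓ w * Dyck (h ⊕ wt x) w ≡ sub E (λ t → Dyck (h ⊕ wt x) t * φₓ t) w
      atGap′ with compare (h ⊕ wt x) 0#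
      ... | tri< p _ _ = trans (trans (cong (sub E φₓ w *_) (Dyck-neg w p)) (*-zeroʳ (sub E φₓ w)))
              (sym (trans (sub-cong (λ _ → refl) (λ t → cong (_* φₓ t) (Dyck-neg t p)) w) (sub-scalar 0ℤ E φₓ w)))
      ... | tri≈ p _ _ = trans (cong (λ k → sub E φₓ w * Dyck k w) (sym (⊕-identityʳ (h ⊕ wt x)))) (sub-Dyck 0# (h ⊕ wt x) φₓ p w)
      ... | tri> p _ _ = trans (cong (λ k → sub E φₓ w * Dyck k w) (sym (⊕-identityʳ (h ⊕ wt x)))) (sub-Dyck 0# (h ⊕ wt x) φₓ p w)

    byCases : sub (Dyck g) φ (x ∷ w) * Dyck (h ⊕ g) (x ∷ w) ≡ sub (Dyck g) (λ t → Dyck h t * φ t) (x ∷ w)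
    byCases with compare g 0# | inGap
    ... | tri< _ _ _ | _ = trans (cong (_* Dyck (h ⊕ g) (x ∷ w)) (trans (+-identityˡ _) (sub-zeroˡ φ w)))
            (sym (trans (+-identityˡ _) (sub-zeroˡ _ w)))
    ... | tri> ¬p _ _ | inGap′ = trans (cong (_* Dyck (h ⊕ g) (x ∷ w)) (+-identityˡ (sub (Dyck (g ⊕ wt x)) φ w))) (trans (inGap′ ¬p) (sym (+-identityˡ _)))
    ... | tri≈ ¬p refl _ | inGap′ = trans (*-distribʳ-+ (Dyck (h ⊕ 0#) (x ∷ w)) (1ℤ * sub E φₓ w) _)
            (cong₂ _+_ (trans (*-assoc 1ℤ (sub E φₓ w) _) (cong (1ℤ *_)
              (trans (cong (λ k → sub E φₓ w * Dyck k (x ∷ w)) (⊕-identityʳ h)) atGap))) (inGap′ ¬p))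

  -- By `sub-Dyck` the condition on the skeleton is a condition on the whole walk and leaves the
  -- sum, which then counts the free reductions of `w`.
  sub-Tree-∷ : ∀ x w → sub E Free w ≡ 1ℤ → sub E (Tree ∘ (x ∷_)) w ≡ Dyck (wt x) w
  sub-Tree-∷ x w eq with compare (wt x) 0#
  ... | tri< p _ _ = trans (sub-cong (λ _ → refl) (λ t → cong (_* Free t) (Dyck-neg t p)) w)
          (trans (sub-scalar 0ℤ E Free w) (sym (Dyck-neg w p)))
  ... | tri≈ ¬p _ _ = trans (sym (sub-Dyck 0# (wt x) Free ¬p w))
          (trans (cong₂ (λ a k → a * Dyck k w) eq (⊕-identityʳ (wt x))) (*-identityˡ _))
  ... | tri> ¬p _ _ = trans (sym (sub-Dyck 0# (wt x) Free ¬p w))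
          (trans (cong₂ (λ a k → a * Dyck k w) eq (⊕-identityʳ (wt x))) (*-identityˡ _))

  -- Every word reduces to exactly one excursion-free word by deleting Dyck words.
  sub-Free : ∀ w → sub E Free w ≡ 1ℤ
  sub-Free w = bounded (length w) w ℕ.≤-refl
    where
    bounded : ∀ n w → length w ℕ.≤ n → sub E Free w ≡ 1ℤ
    bounded n       []      _ = trans (*-identityʳ _) (sgn-zero refl)
    bounded (suc n) (x ∷ w) (ℕ.s≤s le) = begin
      E [] * sub E (Free ∘ (x ∷_)) w + sub (E ∘ (x ∷_)) Free w
        ≡⟨ cong₂ _+_ (trans (cong (_* sub E (Free ∘ (x ∷_)) w) (sgn-zero refl)) (*-identityˡ _))
             (trans (sub-cong (E-∷ x) (λ _ → refl) w) (sub-Λ (Dyck (wt x)) Free w)) ⟩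
      sub E (Free ∘ (x ∷_)) w + (Dyck (wt x) · Λ Free) w
        -- If `x` is deleted, the gap `x ∷ u` is itself replaced by a tree word with insertions.
        -- Both cases then sum over skeletons of `w`, and `Free-∷` merges them into free ones.
        ≡⟨ +-congˡ (sub E (Free ∘ (x ∷_)) w) (cut-cong w (λ u v eq → cong (_* Λ Free v)
             (sym (sub-Tree-∷ x u (bounded n u (ℕ.≤-trans (shorter u v eq) le)))))) ⟩
      sub E (Free ∘ (x ∷_)) w + (sub E (Tree ∘ (x ∷_)) · Λ Free) w
        ≡⟨ +-congˡ (sub E (Free ∘ (x ∷_)) w) (sym (sub-· E (Tree ∘ (x ∷_)) Free w)) ⟩
      sub E (Free ∘ (x ∷_)) w + sub E (Tree ∘ (x ∷_) · Free) w
        ≡⟨ sym (sub-distrib-+ E (Free ∘ (x ∷_)) (Tree ∘ (x ∷_) · Free) w) ⟩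
      sub E (λ t → Free (x ∷ t) + (Tree ∘ (x ∷_) · Free) t) w
        ≡⟨ sub-cong (λ _ → refl) (λ t → sym (Free-∷ x t)) w ⟩
      sub E Free w
        ≡⟨ bounded n w le ⟩
      1ℤ ∎
      where
      shorter : ∀ u v → u ++ v ≡ w → length u ℕ.≤ length w
      shorter u v refl = subst (length u ℕ.≤_) (sym (length-++ u)) (ℕ.m≤m+n (length u) (length v))

  E-Tree : ∀ w → E w ≡ 𝟙 w + Λ Tree w
  E-Tree []      = sgn-zero refl
  E-Tree (x ∷ w) = trans (E-∷ x w) (sym (trans (+-identityˡ _) (sub-Tree-∷ x w (sub-Free w))))

-- Spitzer's identity and substitution for sums over permutations

module Counting (G : OrdAbGroup) {A : Set} (wt : A → OrdAbGroup.Carrier G) where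

  open Walks G wt
  open OrdAbGroup G using (0#; isAbelianGroup) renaming (_+_ to _⊕_; _≟_ to _≟ᵍ_)
  open IsAbelianGroup isAbelianGroup using () renaming (assoc to ⊕-assoc; identityˡ to ⊕-identityˡ; comm to ⊕-comm)

  zeroSum : List A → ℤ
  zeroSum S = sgn (wsum S) 0ℤ 1ℤ 0ℤ

  cyclic : List A → ℤ
  cyclic S = sgn (wsum S) 0ℤ (+ ((length S ∸ 1) !)) 0ℤ

  open Exponential cyclic

  wsum-↭ : ∀ {u v} → u ↭ v → wsum u ≡ wsum v
  wsum-↭ Perm.refl         = refl
  wsum-↭ (Perm.prep x p)   = cong (wt x ⊕_) (wsum-↭ p)
  wsum-↭ (Perm.trans p q)  = trans (wsum-↭ p) (wsum-↭ q)
  wsum-↭ {x ∷ y ∷ u} {y ∷ x ∷ v} (Perm.swap x y p) = begin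
    wt x ⊕ (wt y ⊕ wsum u) ≡⟨ sym (⊕-assoc (wt x) (wt y) (wsum u)) ⟩
    wt x ⊕ wt y ⊕ wsum u   ≡⟨ cong₂ _⊕_ (⊕-comm (wt x) (wt y)) (wsum-↭ p) ⟩
    wt y ⊕ wt x ⊕ wsum v   ≡⟨ ⊕-assoc (wt y) (wt x) (wsum v) ⟩
    wt y ⊕ (wt x ⊕ wsum v) ∎

  Φ-zero : ∀ (S : List A) → Φ (λ _ → 0ℤ) S ≡ 0ℤ
  Φ-zero S = *-distribˡ-∑ 0ℤ (permutations S) (λ _ → 0ℤ)

  Φ-𝟙 : Φ 𝟙 ≗ 𝟙 {A}
  Φ-𝟙 []      = refl
  Φ-𝟙 (x ∷ S) = trans (Φ-cong (x ∷ S) nonempty) (Φ-zero (x ∷ S))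
    where
    nonempty : ∀ w → w ↭ x ∷ S → 𝟙 w ≡ 0ℤ
    nonempty []      p = contradiction (↭-length p) (λ ())
    nonempty (_ ∷ _) p = refl

  Φ-D : ∀ (φ : List A → ℤ) S → Φ (D φ) S ≡ D (Φ φ) S
  Φ-D φ S = trans (Φ-cong S (λ w p → cong (λ n → + n * φ w) (↭-length p))) (*-distribˡ-∑ (+ length S) (permutations S) φ)

  Φ-zeroSum : ∀ φ S → Φ (λ w → zeroSum w * φ w) S ≡ zeroSum S * Φ φ S
  Φ-zeroSum φ S = trans (Φ-cong S (λ w p → cong (λ k → sgn k 0ℤ 1ℤ 0ℤ * φ w) (wsum-↭ p))) (*-distribˡ-∑ (zeroSum S) (permutations S) φ)

  ΦE-cong : ∀ S {y z} → (wsum S ≡ 0# → y ≡ z) → Φ E S * y ≡ Φ E S * z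
  ΦE-cong S {y} {z} f with wsum S ≟ᵍ 0#
  ... | yes p = cong (Φ E S *_) (f p)
  ... | no ¬p = trans (cong (_* y) ΦE≡0) (cong (_* z) (sym ΦE≡0))
    where
    ΦE≡0 : Φ E S ≡ 0ℤ
    ΦE≡0 = trans (Φ-cong S (λ w w↭S → trans (sym (*-identityʳ (E w)))
      (trans (E-cong w (λ q → contradiction (trans (sym (wsum-↭ w↭S)) q) ¬p)) (*-zeroʳ (E w))))) (Φ-zero S)

  e p q : List A → ℤ
  e = Φ E
  p = Φ Excursion
  q = Φ (λ w → zeroSum w * (Ascent · Descent) w)

  e-firstReturn : ∀ S → e S ≡ 𝟙 S + (p ⊛ e) S
  e-firstReturn S = begin
    Φ E S                                    ≡⟨ ∑-cong (permutations S) E-firstReturn ⟩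
    Φ (λ w → 𝟙 w + (Excursion · E) w) S      ≡⟨ ∑-distrib-+ (permutations S) 𝟙 (Excursion · E) ⟩
    Φ 𝟙 S + Φ (Excursion · E) S              ≡⟨ cong₂ _+_ (Φ-𝟙 S) (Φ-· Excursion E S) ⟩
    𝟙 S + (p ⊛ e) S                          ∎

  q-marked : ∀ S → q S + p S ≡ 𝟙 S + D p S
  q-marked S = begin
    q S + p S                                ≡⟨ sym (∑-distrib-+ (permutations S) _ Excursion) ⟩
    Φ (λ w → zeroSum w * (Ascent · Descent) w + Excursion w) S
                                             ≡⟨ ∑-cong (permutations S) marked-excursion ⟩
    Φ (λ w → 𝟙 w + D Excursion w) S          ≡⟨ ∑-distrib-+ (permutations S) 𝟙 (D Excursion) ⟩
    Φ 𝟙 S + Φ (D Excursion) S                ≡⟨ cong₂ _+_ (Φ-𝟙 S) (Φ-D Excursion S) ⟩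
    𝟙 S + D p S                              ∎

  -- Cut a word at its first and last minimum; if its sum is zero, the two
  -- outer pieces together are a rotated excursion.
  bridges : ∀ S → 𝟙 S + D cyclic S ≡ (e ⊛ q) S
  bridges S = begin
    𝟙 S + D cyclic S
      ≡⟨ count S ⟩
    zeroSum S * + (length S !)
      ≡⟨ cong (zeroSum S *_) (sym (trans (∑-cong (permutations S) lastMinimum) (Φ-one S))) ⟩
    zeroSum S * Φ (WeakDescent · Ascent) S
      ≡⟨ cong (zeroSum S *_) (begin
           Φ (WeakDescent · Ascent) S             ≡⟨ Φ-· WeakDescent Ascent S ⟩
           (Φ WeakDescent ⊛ Φ Ascent) S           ≡⟨ ⊛-cong {b = Φ Ascent} (λ T → trans (∑-cong (permutations T) WeakDescent-Dyck) (Φ-· Descent E T)) (λ _ → refl) S ⟩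
           (Φ Descent ⊛ e ⊛ Φ Ascent) S           ≡⟨ ⊛-cong {b = Φ Ascent} (⊛-comm (Φ Descent) e) (λ _ → refl) S ⟩
           (e ⊛ Φ Descent ⊛ Φ Ascent) S           ≡⟨ ⊛-assoc e (Φ Descent) (Φ Ascent) S ⟩
           (e ⊛ (Φ Descent ⊛ Φ Ascent)) S         ≡⟨ ⊛-cong {a = e} (λ _ → refl) (λ U → trans (⊛-comm (Φ Descent) (Φ Ascent) U) (sym (Φ-· Ascent Descent U))) S ⟩
           (e ⊛ Φ (Ascent · Descent)) S           ∎) ⟩
    zeroSum S * (e ⊛ Φ (Ascent · Descent)) S
      ≡⟨ sym (⊛-scalarʳ (zeroSum S) e (Φ (Ascent · Descent)) S) ⟩
    (e ⊛ (λ U → zeroSum S * Φ (Ascent · Descent) U)) S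
      -- Where `e T` is nonzero, `T` has sum zero, so the condition on `S` passes to the outer
      -- pieces `U`.
      ≡⟨ split-cong S (λ {T} {U} i → trans
           (ΦE-cong T (λ T≡0 → cong (λ k → sgn k 0ℤ 1ℤ 0ℤ * Φ (Ascent · Descent) U) (begin
             wsum S            ≡⟨ trans (wsum-↭ (toPermutation i)) (wsum-++ T U) ⟩
             wsum T ⊕ wsum U   ≡⟨ cong (_⊕ wsum U) T≡0 ⟩
             0# ⊕ wsum U       ≡⟨ ⊕-identityˡ (wsum U) ⟩
             wsum U            ∎)))
           (cong (e T *_) (sym (Φ-zeroSum (Ascent · Descent) U)))) ⟩
    (e ⊛ q) S ∎
    where
    scale : ∀ k n m → sgn k 0ℤ 1ℤ 0ℤ * + (suc n ℕ.* m) ≡ + suc n * sgn k 0ℤ (+ m) 0ℤ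
    scale k n m = begin
      sgn k 0ℤ 1ℤ 0ℤ * + (suc n ℕ.* m)          ≡⟨ sgn-* k 0ℤ 1ℤ 0ℤ _ ⟩
      sgn k 0ℤ (1ℤ * + (suc n ℕ.* m)) 0ℤ        ≡⟨ cong (λ z → sgn k 0ℤ z 0ℤ) (trans (*-identityˡ _) (trans (pos-* (suc n) m) (*-comm (+ suc n) (+ m)))) ⟩
      sgn k 0ℤ (+ m * + suc n) 0ℤ               ≡⟨ sym (sgn-* k 0ℤ (+ m) 0ℤ (+ suc n)) ⟩
      sgn k 0ℤ (+ m) 0ℤ * + suc n               ≡⟨ *-comm _ (+ suc n) ⟩
      + suc n * sgn k 0ℤ (+ m) 0ℤ               ∎
    -- At `[]` there is one ordering, but `D` gives 0; the term `𝟙` supplies it.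
    count : ∀ S → 𝟙 S + D cyclic S ≡ zeroSum S * + (length S !)
    count []      = sym (trans (*-identityʳ _) (sgn-zero refl))
    count (x ∷ S) = trans (+-identityˡ _) (sym (scale (wsum (x ∷ S)) (length S) (length S !)))

  -- Insert q = 𝟙 + D p - p into `bridges` and use e - e ⊛ p = 𝟙. This is the derivative of C =
  -- -log(1 - p).
  cyclic-firstReturn : ∀ S → D cyclic S ≡ (e ⊛ D p) S
  cyclic-firstReturn S = solveFor (𝟙 S) (D cyclic S) ((e ⊛ p) S) (e S) ((e ⊛ D p) S)
    (begin
      𝟙 S + D cyclic S + (e ⊛ p) S           ≡⟨ cong (_+ (e ⊛ p) S) (bridges S) ⟩
      (e ⊛ q) S + (e ⊛ p) S                  ≡⟨ sym (⊛-distribˡ-+ e q p S) ⟩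
      (e ⊛ (λ U → q U + p U)) S              ≡⟨ ⊛-cong {a = e} (λ _ → refl) q-marked S ⟩
      (e ⊛ (λ U → 𝟙 U + D p U)) S            ≡⟨ ⊛-distribˡ-+ e 𝟙 (D p) S ⟩
      (e ⊛ 𝟙) S + (e ⊛ D p) S                ≡⟨ cong (_+ (e ⊛ D p) S) (trans (⊛-comm e 𝟙 S) (⊛-identityˡ e S)) ⟩
      e S + (e ⊛ D p) S                      ∎)
    (trans (e-firstReturn S) (+-congˡ (𝟙 S) (⊛-comm p e S)))
    where
    ⊛-distribˡ-+ : ∀ (a b c : List A → ℤ) S → (a ⊛ (λ U → b U + c U)) S ≡ (a ⊛ b) S + (a ⊛ c) S
    ⊛-distribˡ-+ a b c S = trans (⊛-comm a _ S) (trans (⊛-distribʳ-+ a b c S) (cong₂ _+_ (⊛-comm b a S) (⊛-comm c a S)))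
    solveFor : ∀ a b c d f → a + b + c ≡ d + f → d ≡ a + c → b ≡ f
    solveFor a b c d f eq refl = ℤ-cancelˡ (a + c) b f (trans (reorder a b c) eq)
      where
      reorder : ∀ a b c → a + c + b ≡ a + b + c
      reorder = solve-∀

  -- Differentiating e = 1/(1 - p) gives D e = e ⊛ D p ⊛ e. Instead of forming the inverse, `solved`
  -- adds e ⊛ p ⊛ D e to both sides and cancels it.
  e-exp : e ≗ exp 1ℤ
  e-exp = exp-unique e (trans (+-identityʳ _) (sgn-zero refl)) (λ S → begin
    D e S                       ≡⟨ solved S ⟩
    (e ⊛ (D p ⊛ e)) S           ≡⟨ sym (⊛-assoc e (D p) e S) ⟩
    (e ⊛ D p ⊛ e) S             ≡⟨ ⊛-cong {b = e} (sym ∘ cyclic-firstReturn) (λ _ → refl) S ⟩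
    (D cyclic ⊛ e) S            ∎)
    where
    derived : ∀ S → D e S ≡ (D p ⊛ e) S + (p ⊛ D e) S
    derived S = begin
      + length S * e S                                    ≡⟨ cong (+ length S *_) (e-firstReturn S) ⟩
      + length S * (𝟙 S + (p ⊛ e) S)                      ≡⟨ *-distribˡ-+ (+ length S) (𝟙 S) _ ⟩
      + length S * 𝟙 S + D (p ⊛ e) S                      ≡⟨ cong₂ _+_ (D𝟙 S) (D-⊛ p e S) ⟩
      0ℤ + ((D p ⊛ e) S + (p ⊛ D e) S)                    ≡⟨ +-identityˡ _ ⟩
      (D p ⊛ e) S + (p ⊛ D e) S                           ∎
      where
      D𝟙 : ∀ (S : List A) → D 𝟙 S ≡ 0ℤ
      D𝟙 []      = refl
      D𝟙 (_ ∷ S) = *-zeroʳ (+ suc (length S))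

    solved : ∀ S → D e S ≡ (e ⊛ (D p ⊛ e)) S
    solved S = ℤ-cancelʳ ((e ⊛ (p ⊛ D e)) S) _ _ (begin
      D e S + (e ⊛ (p ⊛ D e)) S
        ≡⟨ cong₂ _+_ (sym (⊛-identityˡ (D e) S)) (trans (⊛-swapˡ e p (D e) S) (sym (⊛-assoc p e (D e) S))) ⟩
      (𝟙 ⊛ D e) S + (p ⊛ e ⊛ D e) S
        ≡⟨ sym (⊛-distribʳ-+ (D e) 𝟙 (p ⊛ e) S) ⟩
      ((λ T → 𝟙 T + (p ⊛ e) T) ⊛ D e) S
        ≡⟨ ⊛-cong {b = D e} (sym ∘ e-firstReturn) (λ _ → refl) S ⟩
      (e ⊛ D e) S
        ≡⟨ ⊛-cong {a = e} (λ _ → refl) derived S ⟩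
      (e ⊛ (λ U → (D p ⊛ e) U + (p ⊛ D e) U)) S
        ≡⟨ trans (⊛-comm e _ S) (⊛-distribʳ-+ e (D p ⊛ e) (p ⊛ D e) S) ⟩
      ((D p ⊛ e) ⊛ e) S + ((p ⊛ D e) ⊛ e) S
        ≡⟨ cong₂ _+_ (⊛-comm (D p ⊛ e) e S) (⊛-comm (p ⊛ D e) e S) ⟩
      (e ⊛ (D p ⊛ e)) S + (e ⊛ (p ⊛ D e)) S ∎)

  compose : (List A → ℤ) → List A → ℤ
  compose a S = split (λ T U → a T * exp (+ length T) U) S

  -- The factor `e` is the gap behind a first letter that is not counted in `T`; it raises the
  -- exponent by one.
  exp-compose : ∀ a S → (e ⊛ compose a) S ≡ split (λ T U → a T * exp (+ suc (length T)) U) S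
  exp-compose a S = begin
    (e ⊛ compose a) S
      ≡⟨ ⊛-comm e (compose a) S ⟩
    split (λ R V → split (λ T U → a T * exp (+ length T) U) R * e V) S
      ≡⟨ split-cong S (λ {R} {V} _ → trans (*-comm _ (e V)) (trans (sym (*-distribˡ-split (e V) _ R))
           (split-cong R (λ {T} {U} _ → trans (*-comm (e V) _) (*-assoc (a T) _ (e V)))))) ⟩
    split (λ R V → split (λ T U → a T * (exp (+ length T) U * e V)) R) S
      ≡⟨ split-assoc (λ T U V → a T * (exp (+ length T) U * e V)) S ⟩
    split (λ T R → split (λ U V → a T * (exp (+ length T) U * e V)) R) S
      ≡⟨ split-cong S (λ {T} {R} _ → trans (*-distribˡ-split (a T) _ R) (cong (a T *_) (begin
           (exp (+ length T) ⊛ e) R             ≡⟨ ⊛-cong {a = exp (+ length T)} (λ _ → refl) e-exp R ⟩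
           (exp (+ length T) ⊛ exp 1ℤ) R        ≡⟨ exp-+ (+ length T) 1ℤ R ⟩
           exp (+ length T + 1ℤ) R              ≡⟨ cong (λ k → exp k R) (+-comm (+ length T) 1ℤ) ⟩
           exp (+ suc (length T)) R             ∎))) ⟩
    split (λ T U → a T * exp (+ suc (length T)) U) S ∎

  -- Each skeleton letter brings one gap, hence one factor e^C. As `Λ` has no leading gap, the first
  -- letter of the word is the first skeleton letter, and peeling it off drives the induction.
  Φ-Λ : ∀ φ → Φ (Λ φ) ≗ compose (Φ φ)
  Φ-Λ φ S = bounded (length S) φ S ℕ.≤-refl
    where
    bounded : ∀ n φ S → length S ℕ.≤ n → Φ (Λ φ) S ≡ compose (Φ φ) S
    bounded n       φ []      _ = sym (*-identityʳ _)
    bounded (suc n) φ (x ∷ S) (ℕ.s≤s le) = begin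
      Φ (Λ φ) (x ∷ S)
        ≡⟨ Φ-pick (Λ φ) x S ⟩
      pick (λ y → Φ (sub E (φ ∘ (y ∷_)))) (x ∷ S)
        ≡⟨ pick-cong (x ∷ S) (λ y U eq → begin
             Φ (sub E (φ ∘ (y ∷_))) U                  ≡⟨ ∑-cong (permutations U) (sub-Λ E (φ ∘ (y ∷_))) ⟩
             Φ (E · Λ (φ ∘ (y ∷_))) U                  ≡⟨ Φ-· E (Λ (φ ∘ (y ∷_))) U ⟩
             (e ⊛ Φ (Λ (φ ∘ (y ∷_)))) U                ≡⟨ ⊛-congʳ-≤ e U (λ V V≤U → bounded n (φ ∘ (y ∷_)) V
                                                            (ℕ.≤-trans V≤U (ℕ.≤-trans (ℕ.≤-reflexive (ℕ.suc-injective eq)) le))) ⟩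
             (e ⊛ compose (Φ (φ ∘ (y ∷_)))) U          ≡⟨ exp-compose (Φ (φ ∘ (y ∷_))) U ⟩
             split (ψ y) U                             ∎) ⟩
      pick (λ y → split (ψ y)) (x ∷ S)
        ≡⟨ pick-split ψ (x ∷ S) ⟩
      split (λ T U → pick (λ y T′ → ψ y T′ U) T) (x ∷ S)
        ≡⟨ split-cong (x ∷ S) collect ⟩
      compose (Φ φ) (x ∷ S) ∎
      where
      ψ : A → List A → List A → ℤ
      ψ y T U = Φ (φ ∘ (y ∷_)) T * exp (+ suc (length T)) U
      collect : ∀ {T U} → Interleaving T U (x ∷ S) → pick (λ y T′ → ψ y T′ U) T ≡ Φ φ T * exp (+ length T) U
      -- An empty skeleton has no gap to hold the remaining letters, in accordance with `exp 0ℤ`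
      -- being `𝟙`.
      collect {[]} {y ∷ U} (consʳ i) = sym (trans (cong (Φ φ [] *_) (exp-0 (y ∷ U))) (*-zeroʳ (Φ φ [])))
      collect {t ∷ T} {U} _ = begin
        pick (λ y T′ → ψ y T′ U) (t ∷ T)
          ≡⟨ pick-cong (t ∷ T) (λ y T′ eq → trans (cong (λ n → Φ (φ ∘ (y ∷_)) T′ * exp (+ n) U) eq)
               (*-comm (Φ (φ ∘ (y ∷_)) T′) (exp (+ suc (length T)) U))) ⟩
        pick (λ y T′ → exp (+ suc (length T)) U * Φ (φ ∘ (y ∷_)) T′) (t ∷ T)
          ≡⟨ *-distribˡ-pick (exp (+ suc (length T)) U) (λ y → Φ (φ ∘ (y ∷_))) (t ∷ T) ⟩
        exp (+ suc (length T)) U * pick (λ y → Φ (φ ∘ (y ∷_))) (t ∷ T)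
          ≡⟨ trans (cong (exp (+ suc (length T)) U *_) (sym (Φ-pick φ t T))) (*-comm (exp (+ suc (length T)) U) _) ⟩
        Φ φ (t ∷ T) * exp (+ suc (length T)) U ∎

  Φ-Tree : ∀ x S → let n = + suc (length S) in (1ℤ - n) * Φ Tree (x ∷ S) ≡ exp (1ℤ - n) (x ∷ S)
  Φ-Tree = lagrange (Φ Tree) (λ S → begin
    exp 1ℤ S                        ≡⟨ sym (e-exp S) ⟩
    Φ E S                           ≡⟨ ∑-cong (permutations S) E-Tree ⟩
    Φ (λ w → 𝟙 w + Λ Tree w) S      ≡⟨ ∑-distrib-+ (permutations S) 𝟙 (Λ Tree) ⟩
    Φ 𝟙 S + Φ (Λ Tree) S            ≡⟨ cong₂ _+_ (Φ-𝟙 S) (Φ-Λ Tree S) ⟩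
    𝟙 S + compose (Φ Tree) S        ∎)

-- Positive tree permutations as words

module Characterization (G : OrdAbGroup) {A : Set} (wt : A → OrdAbGroup.Carrier G) where

  open Walks G wt
  open Passport G using (H; IsPositive; TreeCond1; TreeCond2; TreeCond3; IsPositiveTree)
  open OrdAbGroup G using (Carrier; 0#; _<ᵍ_; _<ᵍ?_; Σ[_]; isAbelianGroup; isStrictTotalOrder)
    renaming (_+_ to _⊕_)
  open IsStrictTotalOrder isStrictTotalOrder using (compare) renaming (irrefl to <ᵍ-irrefl; asym to <ᵍ-asym)
  open IsAbelianGroup isAbelianGroup using ()
    renaming (assoc to ⊕-assoc; identityˡ to ⊕-identityˡ; identityʳ to ⊕-identityʳ; comm to ⊕-comm)

  weightGroup : AbelianGroup _ _
  weightGroup = record { isAbelianGroup = isAbelianGroup }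

  open GroupProperties (AbelianGroup.group weightGroup) using (identityʳ-unique)

  height : List A → ℕ → Carrier
  height w i = wsum (take i w)

  height-all : ∀ w → height w (length w) ≡ wsum w
  height-all w = cong wsum (take-all (length w) w ℕ.≤-refl)

  height-++ : ∀ u v i → height (u ++ v) (length u ℕ.+ i) ≡ wsum u ⊕ height v i
  height-++ []      v i = sym (⊕-identityˡ (height v i))
  height-++ (x ∷ u) v i = trans (cong (wt x ⊕_) (height-++ u v i)) (sym (⊕-assoc (wt x) (wsum u) (height v i)))

  height-prefix : ∀ u v → height (u ++ v) (length u) ≡ wsum u
  height-prefix u v = begin
    height (u ++ v) (length u)         ≡⟨ cong (height (u ++ v)) (sym (ℕ.+-identityʳ (length u))) ⟩
    height (u ++ v) (length u ℕ.+ 0)   ≡⟨ height-++ u v 0 ⟩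
    wsum u ⊕ 0#                        ≡⟨ ⊕-identityʳ (wsum u) ⟩
    wsum u                             ∎

  splitAtIndex : ∀ n (w : List A) → n ℕ.< length w → ∃[ u ] ∃[ y ] ∃[ t ] (w ≡ u ++ y ∷ t × length u ≡ n)
  splitAtIndex zero    (x ∷ w) _       = [] , x , w , refl , refl
  splitAtIndex (suc n) (x ∷ w) (s≤s p) with splitAtIndex n w p
  ... | u , y , t , refl , refl = x ∷ u , y , t , refl , refl

  shift : ∀ h x w j → h ⊕ height (x ∷ w) (suc j) ≡ h ⊕ wt x ⊕ height w j
  shift h x w j = sym (⊕-assoc h (wt x) (height w j))

  Dyck-complete : ∀ h w → (∀ i → i ℕ.≤ length w → ¬ (h ⊕ height w i <ᵍ 0#)) → h ⊕ wsum w ≡ 0# → Dyck h w ≡ 1ℤ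
  Dyck-complete h []      nonneg closed = sgn-zero (trans (sym (⊕-identityʳ h)) closed)
  Dyck-complete h (x ∷ w) nonneg closed with compare h 0# | Dyck-complete (h ⊕ wt x) w
      (λ i i≤ p → nonneg (suc i) (s≤s i≤) (subst (_<ᵍ 0#) (sym (shift h x w i)) p))
      (trans (⊕-assoc h (wt x) (wsum w)) closed)
  ... | tri< p _ _ | _  = contradiction (subst (_<ᵍ 0#) (sym (⊕-identityʳ h)) p) (nonneg 0 z≤n)
  ... | tri≈ _ _ _ | eq = eq
  ... | tri> _ _ _ | eq = eq

  Hit-sound : ∀ h w → Hit h w ≢ 0ℤ →
    ∃[ i ] (i ℕ.≤ length w × h ⊕ height w i ≡ 0# × (∀ j → j ℕ.< i → 0# <ᵍ h ⊕ height w j))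
  Hit-sound h [] hit with compare h 0#
  ... | tri< _ _ _ = contradiction refl hit
  ... | tri≈ _ p _ = 0 , z≤n , trans (⊕-identityʳ h) p , λ _ ()
  ... | tri> _ _ _ = contradiction refl hit
  Hit-sound h (x ∷ w) hit with compare h 0#
  ... | tri< _ _ _ = contradiction refl hit
  ... | tri≈ _ p _ = 0 , z≤n , trans (⊕-identityʳ h) p , λ _ ()
  ... | tri> _ _ p with Hit-sound (h ⊕ wt x) w hit
  ...   | i , i≤ , zero-i , pos = suc i , s≤s i≤ , trans (shift h x w i) zero-i , λ where
          zero    _         → subst (0# <ᵍ_) (sym (⊕-identityʳ h)) p
          (suc j) (s≤s j<i) → subst (0# <ᵍ_) (sym (shift h x w j)) (pos j j<i)

  Hit-complete : ∀ h w i → i ℕ.≤ length w → h ⊕ height w i ≡ 0# →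
    (∀ j → j ℕ.< i → ¬ (h ⊕ height w j <ᵍ 0#)) → Hit h w ≡ 1ℤ
  Hit-complete h []      zero    _ eq _ = sgn-zero (trans (sym (⊕-identityʳ h)) eq)
  Hit-complete h (x ∷ w) zero    _ eq _ = sgn-zero (trans (sym (⊕-identityʳ h)) eq)
  Hit-complete h (x ∷ w) (suc i) (s≤s i≤) eq nonneg with compare h 0# | Hit-complete (h ⊕ wt x) w i i≤
      (trans (sym (shift h x w i)) eq)
      (λ j j<i p → nonneg (suc j) (s≤s j<i) (subst (_<ᵍ 0#) (sym (shift h x w j)) p))
  ... | tri< p _ _ | _   = contradiction (subst (_<ᵍ 0#) (sym (⊕-identityʳ h)) p) (nonneg 0 (s≤s z≤n))
  ... | tri≈ _ _ _ | _   = refl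
  ... | tri> _ _ _ | hit = hit

  Free-complete : ∀ w → (∀ u y t → w ≡ u ++ y ∷ t → Hit (wt y) t ≡ 0ℤ) → Free w ≡ 1ℤ
  Free-complete []      none = refl
  Free-complete (x ∷ w) none = cong₂ (λ a b → (1ℤ - a) * b) (none [] x w refl)
    (Free-complete w (λ u y t eq → none (x ∷ u) y t (cong (x ∷_) eq)))

  *≢0ˡ : ∀ a {b} → a * b ≢ 0ℤ → a ≢ 0ℤ
  *≢0ˡ a {b} ab≢0 a≡0 = ab≢0 (cong (_* b) a≡0)

  *≢0ʳ : ∀ a {b} → a * b ≢ 0ℤ → b ≢ 0ℤ
  *≢0ʳ a ab≢0 b≡0 = ab≢0 (trans (cong (a *_) b≡0) (*-zeroʳ a))

  Free-sound : ∀ u y t → Free (u ++ y ∷ t) ≢ 0ℤ → Hit (wt y) t ≢ 1ℤ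
  Free-sound []      y t free hit = *≢0ˡ (1ℤ - Hit (wt y) t) free (cong (λ z → 1ℤ - z) hit)
  Free-sound (x ∷ u) y t free     = Free-sound u y t (*≢0ʳ (1ℤ - Hit (wt x) (u ++ y ∷ t)) free)

  -- A Dyck walk returning to 0 early leaves a nonempty Dyck walk, which
  -- starts with an excursion.
  Dyck-Free-positive : ∀ h w → Dyck h w ≢ 0ℤ → Free w ≢ 0ℤ → ∀ i → i ℕ.< length w → 0# <ᵍ h ⊕ height w i
  Dyck-Free-positive h (y ∷ w) dyck free i i< with compare h 0#
  Dyck-Free-positive h (y ∷ w) dyck free i i<             | tri< _ _ _ = contradiction refl dyck
  Dyck-Free-positive h (y ∷ w) dyck free i i<             | tri≈ _ refl _ =
    case i*j≡0⇒i≡0∨j≡0 (Dyck (wt y) w) (Dyck⇒Hit (wt y) w) of λ where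
      (inj₁ p) → contradiction (trans (cong (λ k → Dyck k w) (⊕-identityˡ (wt y))) p) dyck
      (inj₂ p) → contradiction p (*≢0ˡ (1ℤ - Hit (wt y) w) free)
  Dyck-Free-positive h (y ∷ w) dyck free zero    i<       | tri> _ _ p = subst (0# <ᵍ_) (sym (⊕-identityʳ h)) p
  Dyck-Free-positive h (y ∷ w) dyck free (suc i) (s≤s i<) | tri> _ _ p =
    subst (0# <ᵍ_) (sym (shift h y w i)) (Dyck-Free-positive (h ⊕ wt y) w dyck (*≢0ʳ (1ℤ - Hit (wt y) w) free) i i<)

  Pos : List A → Set
  Pos w = ∀ i → 1 ℕ.≤ i → i ℕ.< length w → 0# <ᵍ height w i

  NoExcursion : List A → Set
  NoExcursion w = ∀ k l → 1 ℕ.≤ k → k ℕ.< l → l ℕ.≤ length w → height w (k ∸ 1) ≡ height w l → 0# <ᵍ height w l →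
    ∃[ j ] (k ℕ.≤ j × j ℕ.< l × height w j <ᵍ height w (k ∸ 1))

  Tree-complete : (∀ a → wt a ≢ 0#) → ∀ x w → wsum (x ∷ w) ≡ 0# → Pos (x ∷ w) → NoExcursion (x ∷ w) → Tree (x ∷ w) ≡ 1ℤ
  Tree-complete wt≢0 x w closed pos noExc = cong₂ _*_ (Dyck-complete (wt x) w nonneg closed) (Free-complete w noHit)
    where
    nonneg : ∀ i → i ℕ.≤ length w → ¬ (wt x ⊕ height w i <ᵍ 0#)
    nonneg i i≤ p with ℕ.m≤n⇒m<n∨m≡n i≤
    ... | inj₁ i<   = <ᵍ-asym p (pos (suc i) (s≤s z≤n) (s≤s i<))
    ... | inj₂ refl = <ᵍ-irrefl (trans (cong (wt x ⊕_) (height-all w)) closed) p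

    noHit : ∀ u y t → w ≡ u ++ y ∷ t → Hit (wt y) t ≡ 0ℤ
    noHit u y t refl = decidable-stable (Hit (wt y) t ≟ 0ℤ) λ hit → refute (Hit-sound (wt y) t hit)
      where
      a = suc (length u)
      whole = x ∷ u ++ y ∷ t

      inside : ∀ i → height whole (suc a ℕ.+ i) ≡ wsum (x ∷ u) ⊕ (wt y ⊕ height t i)
      inside i = trans (cong (height whole) (sym (ℕ.+-suc a i))) (height-++ (x ∷ u) (y ∷ t) (suc i))

      length-whole : length whole ≡ suc a ℕ.+ length t
      length-whole = trans (cong suc (length-++ u)) (ℕ.+-suc a (length t))

      atStart : height whole a ≡ wsum (x ∷ u)
      atStart = height-prefix (x ∷ u) (y ∷ t)

      refute : ¬ (∃[ i ] (i ℕ.≤ length t × wt y ⊕ height t i ≡ 0# × (∀ j → j ℕ.< i → 0# <ᵍ wt y ⊕ height t j)))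
      -- This would be a one-letter excursion. `NoExcursion` is silent about it, since `k < l` means
      -- at least two letters; nonzero weights exclude it.
      refute (zero , _ , eq , _) = wt≢0 y (trans (sym (⊕-identityʳ (wt y))) eq)
      -- The letter `y` is number `suc a` of the whole word, so the excursion runs from height index
      -- `a` to `suc a + suc i`.
      refute (suc i , i≤ , eq , above) with noExc (suc a) (suc a ℕ.+ suc i) (s≤s z≤n) (ℕ.m<m+n (suc a) (s≤s z≤n))
          (subst (suc a ℕ.+ suc i ℕ.≤_) (sym length-whole) (ℕ.+-monoʳ-≤ (suc a) i≤)) sameHeight
          (subst (0# <ᵍ_) sameHeight (pos a (s≤s z≤n) (subst (a ℕ.<_) (sym length-whole) (s≤s (ℕ.m≤m+n a (length t))))))
        where
        sameHeight : height whole a ≡ height whole (suc a ℕ.+ suc i)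
        sameHeight = begin
          height whole a                                   ≡⟨ atStart ⟩
          wsum (x ∷ u)                                     ≡⟨ sym (⊕-identityʳ (wsum (x ∷ u))) ⟩
          wsum (x ∷ u) ⊕ 0#                                ≡⟨ cong (wsum (x ∷ u) ⊕_) (sym eq) ⟩
          wsum (x ∷ u) ⊕ (wt y ⊕ height t (suc i))         ≡⟨ sym (inside (suc i)) ⟩
          height whole (suc a ℕ.+ suc i)                   ∎
      ... | j , k≤j , j<l , below with ℕ.m≤n⇒∃[o]m+o≡n k≤j
      ...   | j′ , refl = <ᵍ-asym below (subst₂ _<ᵍ_ (sym atStart) (sym (trans (inside j′) (⊕-comm (wsum (x ∷ u)) _)))
                (pos⇒< (wsum (x ∷ u)) (above j′ (ℕ.+-cancelˡ-< (suc a) j′ (suc i) j<l))))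

  Tree⇒Pos : ∀ x w → Tree (x ∷ w) ≢ 0ℤ → Pos (x ∷ w)
  Tree⇒Pos x w tree (suc i) _ (s≤s i<) = Dyck-Free-positive (wt x) w (*≢0ˡ (Dyck (wt x) w) tree) (*≢0ʳ (Dyck (wt x) w) tree) i i<

  -- A closed factor that never goes below its start need not be an excursion, but it begins with
  -- one, up to the first return to the starting height. This contradicts freeness of the tail.
  Tree⇒NoExcursion : ∀ x w → Tree (x ∷ w) ≢ 0ℤ → NoExcursion (x ∷ w)
  -- A factor from the first letter starts at height 0, which is not positive; this matches the
  -- exemption of the first letter in `Tree`.
  Tree⇒NoExcursion x w tree (suc zero) l _ _ _ eq pos = contradiction pos (<ᵍ-irrefl eq)
  Tree⇒NoExcursion x w tree (suc (suc k)) l _ k<l l≤ eq pos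
    with splitAtIndex k w (ℕ.s≤s⁻¹ (ℕ.≤-trans (ℕ.≤-trans (ℕ.n≤1+n _) k<l) l≤)) | ℕ.m≤n⇒∃[o]m+o≡n k<l
  ... | u , y , t , refl , refl | i , refl = decidable-stable lower? λ none →
    Free-sound u y t (*≢0ʳ (Dyck (wt x) (u ++ y ∷ t)) tree)
      (Hit-complete (wt y) t (suc i) i< closed (λ j j<i p → none
        ( suc a ℕ.+ j , ℕ.m≤m+n (suc a) j , subst (suc a ℕ.+ j ℕ.<_) (ℕ.+-suc (suc a) i) (ℕ.+-monoʳ-< (suc a) j<i)
        , subst₂ _<ᵍ_ (sym (trans (inside j) (⊕-comm (wsum (x ∷ u)) _))) (sym atStart) (neg⇒> (wsum (x ∷ u)) p))))
    where
    a = suc (length u)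
    whole = x ∷ u ++ y ∷ t

    inside : ∀ i → height whole (suc a ℕ.+ i) ≡ wsum (x ∷ u) ⊕ (wt y ⊕ height t i)
    inside i = trans (cong (height whole) (sym (ℕ.+-suc a i))) (height-++ (x ∷ u) (y ∷ t) (suc i))

    atStart : height whole a ≡ wsum (x ∷ u)
    atStart = height-prefix (x ∷ u) (y ∷ t)

    i< : i ℕ.< length t
    i< = ℕ.+-cancelˡ-≤ (suc a) (suc i) (length t)
      (subst₂ ℕ._≤_ (sym (ℕ.+-suc (suc a) i)) (trans (cong suc (length-++ u)) (ℕ.+-suc a (length t))) l≤)

    closed : wt y ⊕ height t (suc i) ≡ 0#
    closed = identityʳ-unique (wsum (x ∷ u)) _ (begin
      wsum (x ∷ u) ⊕ (wt y ⊕ height t (suc i))   ≡⟨ sym (inside (suc i)) ⟩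
      height whole (suc a ℕ.+ suc i)             ≡⟨ cong (height whole) (ℕ.+-suc (suc a) i) ⟩
      height whole (suc (suc a) ℕ.+ i)           ≡⟨ sym eq ⟩
      height whole a                             ≡⟨ atStart ⟩
      wsum (x ∷ u)                               ∎)

    lower? : Dec (∃[ j ] (suc a ℕ.≤ j × j ℕ.< suc (suc a) ℕ.+ i × height whole j <ᵍ height whole a))
    lower? = map′ (λ (j , j< , ≤j , p) → j , ≤j , j< , p) (λ (j , ≤j , j< , p) → j , j< , ≤j , p)
      (ℕ.anyUpTo? (λ j → (suc a ℕ.≤? j) ×-dec (height whole j <ᵍ? height whole a)) (suc (suc a) ℕ.+ i))

  H-height : ∀ w i → H (map wt w) i ≡ height w i
  H-height w i = cong Σ[_] (take-map i w)

  Pos⇒IsPositive : ∀ w → Pos w → IsPositive (map wt w)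
  Pos⇒IsPositive w pos i 1≤i i<n = subst (0# <ᵍ_) (sym (H-height w (toℕ i)))
    (pos (toℕ i) 1≤i (subst (toℕ i ℕ.<_) (length-map wt w) i<n))

  IsPositive⇒Pos : ∀ w → IsPositive (map wt w) → Pos w
  IsPositive⇒Pos w pos i 1≤i i<n = subst (0# <ᵍ_) (trans (cong (H (map wt w)) i≡) (H-height w i))
    (pos (fromℕ< (ℕ.m≤n⇒m≤1+n i<n′)) (subst (1 ℕ.≤_) (sym i≡) 1≤i) (subst (ℕ._< length (map wt w)) (sym i≡) i<n′))
    where
    i<n′ : i ℕ.< length (map wt w)
    i<n′ = subst (i ℕ.<_) (sym (length-map wt w)) i<n
    i≡ : toℕ (fromℕ< (ℕ.m≤n⇒m≤1+n i<n′)) ≡ i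
    i≡ = toℕ-fromℕ< (ℕ.m≤n⇒m≤1+n i<n′)

  NoExcursion⇒TreeCond2 : ∀ w → NoExcursion w → TreeCond2 (map wt w)
  NoExcursion⇒TreeCond2 w noExc k l 1≤k k<l eq pos
    with noExc (toℕ k) (toℕ l) 1≤k k<l (subst (toℕ l ℕ.≤_) (length-map wt w) (ℕ.s≤s⁻¹ (toℕ<n l)))
           (trans (sym (H-height w (toℕ k ∸ 1))) (trans eq (H-height w (toℕ l)))) (subst (0# <ᵍ_) (H-height w (toℕ l)) pos)
  ... | j , k≤j , j<l , below = fromℕ< j<n , subst (toℕ k ℕ.≤_) (sym j≡) k≤j , subst (ℕ._< toℕ l) (sym j≡) j<l ,
        subst₂ _<ᵍ_ (sym (trans (cong (H (map wt w)) j≡) (H-height w j))) (sym (H-height w (toℕ k ∸ 1))) below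
    where
    j<n = ℕ.<-trans j<l (toℕ<n l)
    j≡ = toℕ-fromℕ< j<n

  TreeCond2⇒NoExcursion : ∀ w → TreeCond2 (map wt w) → NoExcursion w
  TreeCond2⇒NoExcursion w cond k l 1≤k k<l l≤ eq pos = fromIndices (toℕ-fromℕ< k<n) (toℕ-fromℕ< l<n)
    where
    l<n : l ℕ.< suc (length (map wt w))
    l<n = s≤s (subst (l ℕ.≤_) (sym (length-map wt w)) l≤)
    k<n = ℕ.<-trans k<l l<n

    fromIndices : ∀ {k′ l′ : Fin (suc (length (map wt w)))} → toℕ k′ ≡ k → toℕ l′ ≡ l →
      ∃[ j ] (k ℕ.≤ j × j ℕ.< l × height w j <ᵍ height w (k ∸ 1))
    fromIndices {k′} {l′} refl refl with cond k′ l′ 1≤k k<l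
      (trans (H-height w (k ∸ 1)) (trans eq (sym (H-height w l)))) (subst (0# <ᵍ_) (sym (H-height w l)) pos)
    ... | j , k≤j , j<l , below = toℕ j , k≤j , j<l , subst₂ _<ᵍ_ (H-height w (toℕ j)) (H-height w (k ∸ 1)) below

  Tree-sound : ∀ x w → wsum (x ∷ w) ≡ 0# → Tree (x ∷ w) ≢ 0ℤ → IsPositiveTree (map wt (x ∷ w))
  Tree-sound x w closed tree = positive , cond₁ , NoExcursion⇒TreeCond2 (x ∷ w) (Tree⇒NoExcursion x w tree) , cond₃
    where
    ws = map wt (x ∷ w)

    positive : IsPositive ws
    positive = Pos⇒IsPositive (x ∷ w) (Tree⇒Pos x w tree)

    cond₁ : TreeCond1 ws
    cond₁ i 1≤i i<n eq = <ᵍ-irrefl (sym eq) (positive i 1≤i i<n)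

    cond₃ : TreeCond3 ws
    cond₃ k l 1≤k k<l _ neg with ℕ.m≤n⇒m<n∨m≡n (ℕ.s≤s⁻¹ (toℕ<n l))
    ... | inj₁ l<n = contradiction neg (<ᵍ-asym (positive l (ℕ.≤-trans 1≤k (ℕ.<⇒≤ k<l)) l<n))
    ... | inj₂ l≡n = contradiction neg (<ᵍ-irrefl (begin
      H ws (toℕ l)                       ≡⟨ cong (H ws) (trans l≡n (length-map wt (x ∷ w))) ⟩
      H ws (length (x ∷ w))              ≡⟨ H-height (x ∷ w) (length (x ∷ w)) ⟩
      height (x ∷ w) (length (x ∷ w))    ≡⟨ height-all (x ∷ w) ⟩
      wsum (x ∷ w)                       ≡⟨ closed ⟩
      0#                                 ∎))

  IsPositiveTree⇒Tree : (∀ a → wt a ≢ 0#) → ∀ x w → wsum (x ∷ w) ≡ 0# → IsPositiveTree (map wt (x ∷ w)) → Tree (x ∷ w) ≡ 1ℤ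
  IsPositiveTree⇒Tree wt≢0 x w closed (positive , _ , cond₂ , _) =
    Tree-complete wt≢0 x w closed (IsPositive⇒Pos (x ∷ w) positive) (TreeCond2⇒NoExcursion (x ∷ w) cond₂)

-- From filtered lists to weighted sums, and the final count

when : ∀ {P : Set} → Dec P → ℤ → ℤ
when d z = if does d then z else 0ℤ

when-≡ : ∀ {P : Set} (d : Dec P) {z} → (P → z ≡ 1ℤ) → (¬ P → z ≡ 0ℤ) → when d 1ℤ ≡ z
when-≡ (yes p) f g = sym (f p)
when-≡ (no ¬p) f g = sym (g ¬p)

length-filter-∑ : ∀ {B : Set} {P : B → Set} (P? : ∀ x → Dec (P x)) xs → + length (filter P? xs) ≡ ∑ xs (λ x → when (P? x) 1ℤ)
length-filter-∑ P? []       = refl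
length-filter-∑ P? (x ∷ xs) with P? x
... | yes _ = +-congˡ 1ℤ (length-filter-∑ P? xs)
... | no  _ = trans (length-filter-∑ P? xs) (sym (+-identityˡ _))

sumℤ-filter-∑ : ∀ {B : Set} {P : B → Set} (P? : ∀ x → Dec (P x)) φ xs → sumℤ (map φ (filter P? xs)) ≡ ∑ xs (λ x → when (P? x) (φ x))
sumℤ-filter-∑ P? φ []       = refl
sumℤ-filter-∑ P? φ (x ∷ xs) with P? x
... | yes _ = +-congˡ (φ x) (sumℤ-filter-∑ P? φ xs)
... | no  _ = trans (sumℤ-filter-∑ P? φ xs) (sym (+-identityˡ _))

setPartitions-nonempty : ∀ {A : Set} (x : A) S → All (λ p → 1 ≤ length p) (setPartitions (x ∷ S))
setPartitions-nonempty x S = 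
  All.concat⁺ (All.map⁺ (All.universal (λ p → s≤s z≤n ∷ insertIntoBlock-nonempty p) (setPartitions S)))
  where
  insertIntoBlock-nonempty : ∀ p → All (λ p → 1 ≤ length p) (insertIntoBlock x p)
  insertIntoBlock-nonempty []      = []
  insertIntoBlock-nonempty (b ∷ p) = s≤s z≤n ∷ All.map⁺ (All.universal (λ _ → s≤s z≤n) (insertIntoBlock x p))

module Terms (G : OrdAbGroup) {N : ℕ} (wt : Fin N → OrdAbGroup.Carrier G) where

  open Walks G wt
  open Counting G wt using (cyclic)
  open Exponential cyclic using (weight; exp)
  open Passport G using (X; term; rhs)
  open OrdAbGroup G using (0#; Σ[_]; isStrictTotalOrder) renaming (_≟_ to _≟ᵍ_)
  open IsStrictTotalOrder isStrictTotalOrder using (compare)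

  allZero? : ∀ p → Dec (All (λ b → Σ[ map wt b ] ≡ 0#) p)
  allZero? = All.all? (λ b → Σ[ map wt b ] ≟ᵍ 0#)

  weight-X : ∀ k p → weight k p ≡ when (allZero? p) (k ^ length p * + X wt p)
  weight-X k []      = refl
  weight-X k (b ∷ p) = trans (cong (k * cyclic b *_) (weight-X k p)) step
    where
    m = (length b ∸ 1) !
    rearrange : ∀ a b c d → a * b * (c * d) ≡ a * c * (b * d)
    rearrange = solve-∀
    nonzero : ∀ z → k * 0ℤ * z ≡ 0ℤ
    nonzero z = cong (_* z) (*-zeroʳ k)
    step : k * cyclic b * when (allZero? p) (k ^ length p * + X wt p)
      ≡ when (allZero? (b ∷ p)) (k ^ length (b ∷ p) * + X wt (b ∷ p))
    step with compare (wsum b) 0#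
    ... | tri< _ _ _ = nonzero (when (allZero? p) (k ^ length p * + X wt p))
    ... | tri> _ _ _ = nonzero (when (allZero? p) (k ^ length p * + X wt p))
    ... | tri≈ _ _ _ with allZero? p
    ...   | no _  = *-zeroʳ (k * + m)
    ...   | yes _ = begin
      k * + m * (k ^ length p * + X wt p)        ≡⟨ rearrange k (+ m) (k ^ length p) (+ X wt p) ⟩
      k * k ^ length p * (+ m * + X wt p)        ≡⟨ cong (k * k ^ length p *_) (sym (pos-* m (X wt p))) ⟩
      k * k ^ length p * + (m ℕ.* X wt p)        ∎

  ^-neg : ∀ n l → (- + n) ^ l ≡ -1ℤ ^ l * (+ n) ^ l
  ^-neg n zero    = refl
  ^-neg n (suc l) = trans (cong (- + n *_) (^-neg n l)) (rearrange (+ n) (-1ℤ ^ l) ((+ n) ^ l))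
    where
    rearrange : ∀ n a b → - n * (a * b) ≡ -1ℤ * a * (n * b)
    rearrange = solve-∀

  -- `weight` has one factor `- + (N ∸ 1)` per block, `term` one fewer. As `p` is nonempty, the
  -- truncated `length p ∸ 1` is a true predecessor.
  weight-term : ∀ p → 1 ≤ length p → weight (- + (N ∸ 1)) p ≡ - + (N ∸ 1) * when (allZero? p) (term wt p)
  weight-term p@(_ ∷ p′) _ rewrite weight-X (- + (N ∸ 1)) p with does (allZero? p)
  ... | false = sym (*-zeroʳ (- + (N ∸ 1)))
  ... | true  = trans (*-assoc (- + (N ∸ 1)) _ (+ X wt p))
    (cong (λ z → - + (N ∸ 1) * (z * + X wt p)) (^-neg (N ∸ 1) (length p′)))

  exp-rhs : 1 ≤ N → exp (- + (N ∸ 1)) (allFin N) ≡ - + (N ∸ 1) * rhs wt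
  exp-rhs (s≤s _) = begin
    exp (- + (N ∸ 1)) (allFin N)
      ≡⟨ ∑-congAll (All.map (λ {p} → weight-term p) (setPartitions-nonempty zero (tabulate suc))) ⟩
    ∑ (setPartitions (allFin N)) (λ p → - + (N ∸ 1) * when (allZero? p) (term wt p))
      ≡⟨ *-distribˡ-∑ (- + (N ∸ 1)) (setPartitions (allFin N)) _ ⟩
    - + (N ∸ 1) * ∑ (setPartitions (allFin N)) (λ p → when (allZero? p) (term wt p))
      ≡⟨ cong (- + (N ∸ 1) *_) (sym (sumℤ-filter-∑ allZero? (term wt) (setPartitions (allFin N)))) ⟩
    - + (N ∸ 1) * rhs wt ∎

module _ (G : OrdAbGroup) {N : ℕ} (wt : Fin N → OrdAbGroup.Carrier G) where

  open Passport G using (IsFullPassport; isPositiveTree?; numPT₊)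
  open Walks G wt using (Tree)
  open Counting G wt using (wsum-↭)
  open Characterization G wt

  -- At N = 0 the two counts differ: the empty word satisfies all conditions vacuously, but
  -- `Tree []` is 0.
  numPT₊-Tree : 1 ≤ N → IsFullPassport N wt → + numPT₊ wt ≡ Φ Tree (allFin N)
  numPT₊-Tree (s≤s _) (wt≢0 , closed) = trans
    (length-filter-∑ (λ σ → isPositiveTree? (map wt σ)) (permutations (allFin N)))
    (Φ-cong (allFin N) indicator)
    where
    indicator : ∀ σ → σ ↭ allFin N → when (isPositiveTree? (map wt σ)) 1ℤ ≡ Tree σ
    indicator []      perm = contradiction (↭-length perm) λ ()
    indicator (x ∷ w) perm = when-≡ (isPositiveTree? (map wt (x ∷ w)))
      (IsPositiveTree⇒Tree wt≢0 x w sum≡0)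
      (λ ¬pt → decidable-stable (Tree (x ∷ w) ≟ 0ℤ) (λ tree → ¬pt (Tree-sound x w sum≡0 tree)))
      where sum≡0 = trans (wsum-↭ perm) closed

theorem3p14 : (G : OrdAbGroup) (N : ℕ) → 2 ≤ N →
    (wt : Fin N → OrdAbGroup.Carrier G) → Passport.IsFullPassport G N wt →
    + Passport.numPT₊ G wt ≡ Passport.rhs G wt
-- With N = n + 2 the factor 1 - N is `- + suc n`, which is visibly nonzero and can be cancelled.
theorem3p14 G N@(suc (suc n)) (s≤s (s≤s _)) wt full = *-cancelˡ-≡ (- + suc n) _ _ (begin
  - + suc n * + Passport.numPT₊ G wt     ≡⟨ cong (- + suc n *_) (numPT₊-Tree G wt (s≤s z≤n) full) ⟩
  - + suc n * Φ Tree (allFin N)          ≡⟨ subst (λ l → (1ℤ - + suc l) * Φ Tree (allFin N) ≡ exp (1ℤ - + suc l) (allFin N))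
                                              (length-tabulate {n = suc n} suc) (Φ-Tree zero (tabulate suc)) ⟩
  exp (- + suc n) (allFin N)             ≡⟨ Terms.exp-rhs G wt (s≤s z≤n) ⟩
  - + suc n * Passport.rhs G wt          ∎)
  where
  open Walks G wt using (Tree)
  open Counting G wt using (cyclic; Φ-Tree)
  open Exponential cyclic using (exp)
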